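{- Let $r\geq 2$. There exists $c=c(r)>0$ such that the following holds. Let $H$ be an $r$-uniform hypergraph on $n$ vertices of average degree $d$, where $1\leq d\leq \frac{1}{2}\binom{n-1}{r-1}$. Then $\mathrm{disc}(H)\geq c\sqrt{d}\,n$.
   Context: For an $r$-uniform hypergraph $H$ on $n$ vertices with edge density $p=|E(H)|/\binom{n}{r}$ and $U\subset V(H)$, let $e(U)$ be the number of edges of $H$ contained in $U$ and $\mathrm{disc}(U)=e(U)-p\binom{|U|}{r}$. The discrepancy is $\mathrm{disc}(H)=\max_{U\subset V(H)}|\mathrm{disc}(U)|$. The average degree is $d=r|E(H)|/n$. -}

module Defs where

open import Data.Fin.Subset using (Subset; inside; outside; ∣_∣)
open import Data.Fin.Subset.Properties using (_⊆?_)
open import Data.Integer.Base using (+_)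
open import Data.List.Base using (List; []; _∷_; _++_; map; filter; length)
open import Data.List.Extrema using (max)
open import Data.List.Membership.Propositional using (_∈_)
open import Data.List.Membership.Propositional.Properties using (∈-map⁺; ∈-++⁺ˡ; ∈-++⁺ʳ)
open import Data.List.Relation.Unary.All using (All)
open import Data.List.Relation.Unary.Any using (here)
open import Data.List.Relation.Unary.Unique.Propositional using (Unique)
open import Data.Nat.Base as ℕ using (ℕ; zero; suc)
open import Data.Nat.Combinatorics using (_C_)
open import Data.Product.Base using (_×_)
open import Data.Rational.Base as ℚ using (ℚ; 0ℚ; _/_; _*_; _-_; _≤_)
open import Data.Rational.Properties using (≤-decTotalOrder)
open import Data.Vec.Base as Vec using ()
open import Relation.Binary.Bundles using (DecTotalOrder)
open import Relation.Binary.PropositionalEquality using (_≡_; refl)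

-- The edge set is a duplicate-free list of r-subsets of the vertex set Fin n.
record Hypergraph (r n : ℕ) : Set where
  field
    edges   : List (Subset n)
    uniform : All (λ e → ∣ e ∣ ≡ r) edges
    unique  : Unique edges

open Hypergraph public

fromℕ : ℕ → ℚ
fromℕ m = + m / 1

-- Total division: the value at denominator 0 is a junk value.
ratio : ℕ → ℕ → ℚ
ratio a zero    = 0ℚ
ratio a (suc b) = + a / suc b

allSubsets : (n : ℕ) → List (Subset n)
allSubsets zero    = Vec.[] ∷ []
allSubsets (suc n) =
  map (Vec._∷_ inside) (allSubsets n) ++ map (Vec._∷_ outside) (allSubsets n)

∈-allSubsets : ∀ {n} (U : Subset n) → U ∈ allSubsets n
∈-allSubsets Vec.[]              = here refl
∈-allSubsets (inside  Vec.∷ U) = ∈-++⁺ˡ (∈-map⁺ (Vec._∷_ inside) (∈-allSubsets U))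
∈-allSubsets {suc n} (outside Vec.∷ U) =
  ∈-++⁺ʳ (map (Vec._∷_ inside) (allSubsets n)) (∈-map⁺ (Vec._∷_ outside) (∈-allSubsets U))

module _ {r n : ℕ} (H : Hypergraph r n) where

  edgeCount : ℕ
  edgeCount = length (edges H)

  density : ℚ
  density = ratio edgeCount (n C r)

  averageDegree : ℚ
  averageDegree = ratio (r ℕ.* edgeCount) n

  edgesWithin : Subset n → ℕ
  edgesWithin U = length (filter (_⊆? U) (edges H))

  discOf : Subset n → ℚ
  discOf U = fromℕ (edgesWithin U) - density * fromℕ (∣ U ∣ C r)

  -- The base value 0ℚ does not affect the maximum: allSubsets n is nonempty
  -- and absolute values are nonnegative.
  disc : ℚ
  disc = max (DecTotalOrder.totalOrder ≤-decTotalOrder) 0ℚ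
             (map (λ U → ℚ.∣ discOf U ∣) (allSubsets n))

-- s ≤√ x : s is a nonnegative rational lower bound of √x.  For rational x ≥ 0,
-- the real number √x is the supremum of these s, so for rational a ≥ 0 the
-- inequality a · √x ≤ y over the reals reads: a * s ≤ y for every s ≤√ x.
infix 4 _≤√_
_≤√_ : ℚ → ℚ → Set
s ≤√ x = 0ℚ ≤ s × s * s ≤ x

{-# OPTIONS --safe #-}
module Submission where

-- Write p for the density and w(e) = 1[e ∈ H] − p, so that disc(U) is the value at the
-- indicator of U of the homogeneous multilinear polynomial F(x) = Σ w(e) Π_{i ∈ e} x_i.
-- If |disc(U)| ≤ M for all U, then |F| ≤ M on [0,1]ⁿ by multilinearity, and since all the
-- coefficients of a polynomial of degree r in one variable are O_r(1) times its maximum on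
-- [0,1], restricting F to lines gives |F| = O_r(M) on [-1,1]ⁿ and then
-- Σ_i |∂_i F(x)| = O_r(M) for every x in [-1,1]ⁿ.
-- This is used at two kinds of points.  At x = (1,…,1) the i-th derivative is deg(i) − d.
-- At a uniformly random sign vector it has second moment (1 − 2p) deg(i) + p d, and by the
-- Bonami lemma its first absolute moment is of order √d as soon as deg(i) is within d/2
-- of d.  As d ≥ 1, every vertex contributes at least a constant times √d to one of the
-- two sums, whence √d n = O_r(M).

open import Defs
open import Algebra.Bundles using (CommutativeRing)
open import Data.Bool.Base using (true; false; if_then_else_)
open import Data.Fin.Base using (Fin; zero; suc)
open import Data.Fin.Subset as Sub using (Subset; inside; outside; ⊥; ⊤)
open import Data.Fin.Subset.Properties using (_⊆?_; ∣⊤∣≡n)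
import Data.Integer.Base as ℤ
import Data.Integer.Properties as ℤ
import Data.Integer.Tactic.RingSolver as ℤ
open import Data.List.Base using (List; []; _∷_; length; filter)
open import Data.List.Membership.Propositional.Properties using (∈-map⁺)
open import Data.List.Relation.Unary.All as All using (All; []; _∷_)
open import Data.List.Relation.Unary.AllPairs using ([]; _∷_)
open import Data.List.Relation.Unary.Unique.Propositional using (Unique)
open import Data.Nat.Base as ℕ using (ℕ; zero; suc; z≤n; s≤s; _∸_; _≡ᵇ_)
open import Data.Nat.Combinatorics using (_C_; nC1≡n; nCk+nC[k+1]≡[n+1]C[k+1])
import Data.Nat.Properties as ℕ
import Data.Nat.Tactic.RingSolver as ℕ
open import Data.Product.Base using (∃-syntax; _×_; _,_; proj₁; proj₂)
open import Data.Rational.Base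
open import Data.Rational.Properties
open import Data.Rational.Unnormalised.Base as ℚᵘ using (mkℚᵘ; *≡*)
import Data.Rational.Unnormalised.Properties as ℚᵘ
open import Data.Sum.Base using (inj₁; inj₂; _⊎_)
open import Data.Vec.Base using ([]; _∷_; lookup)
open import Data.Vec.Functional as Vector using (Vector; tail)
open import Data.Vec.Properties using (lookup-replicate)
open import Function.Base using (_∘_; const)
open import Level using (0ℓ)
open import Relation.Binary.Bundles using (DecTotalOrder)
open import Relation.Binary.PropositionalEquality using (_≡_; _≢_; refl; sym; trans; cong; cong₂; module ≡-Reasoning)
open import Relation.Nullary using (Dec; yes; no; does; contradiction)
open import Relation.Nullary.Decidable using (dec⇒maybe)
open import Tactic.RingSolver using (solve-∀)
open import Tactic.RingSolver.Core.AlmostCommutativeRing using (AlmostCommutativeRing; fromCommutativeRing)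
open import Algebra.Properties.CommutativeSemiring.Exp (CommutativeRing.commutativeSemiring +-*-commutativeRing) using (_^_; ^-distrib-*)
open import Algebra.Properties.Semiring.Sum (CommutativeRing.semiring +-*-commutativeRing) using (sum; sum-cong-≗; ∑-distrib-+; *-distribˡ-sum)
open import Data.List.Extrema (DecTotalOrder.totalOrder ≤-decTotalOrder) using (xs≤max)

-- Ordered-field arithmetic over the rationals

ringℚ : AlmostCommutativeRing 0ℓ 0ℓ
ringℚ = fromCommutativeRing +-*-commutativeRing λ x → dec⇒maybe (0ℚ ≟ x)

2ℚ 3ℚ 4ℚ 8ℚ : ℚ
2ℚ = ℤ.+ 2 / 1
3ℚ = ℤ.+ 3 / 1
4ℚ = ℤ.+ 4 / 1
8ℚ = ℤ.+ 8 / 1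

0≤1 : 0ℚ ≤ 1ℚ
0≤1 = ≤ᵇ⇒≤ _

0≤½ : 0ℚ ≤ ½
0≤½ = ≤ᵇ⇒≤ _

0≤2 : 0ℚ ≤ 2ℚ
0≤2 = ≤ᵇ⇒≤ _

0≤3 : 0ℚ ≤ 3ℚ
0≤3 = ≤ᵇ⇒≤ _

0≤8 : 0ℚ ≤ 8ℚ
0≤8 = ≤ᵇ⇒≤ _

≤-respˡ : ∀ {p q r : ℚ} → p ≡ q → q ≤ r → p ≤ r
≤-respˡ refl h = h

≤-respʳ : ∀ {p q r : ℚ} → q ≡ r → p ≤ q → p ≤ r
≤-respʳ refl h = h

0≤+ : ∀ {p q} → 0ℚ ≤ p → 0ℚ ≤ q → 0ℚ ≤ p + q
0≤+ = +-mono-≤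

*-monoˡ-≤ : ∀ {c p q} → 0ℚ ≤ c → p ≤ q → c * p ≤ c * q
*-monoˡ-≤ {c} 0≤c = *-monoˡ-≤-nonNeg c {{nonNegative 0≤c}}

*-monoʳ-≤ : ∀ {c p q} → 0ℚ ≤ c → p ≤ q → p * c ≤ q * c
*-monoʳ-≤ {c} 0≤c = *-monoʳ-≤-nonNeg c {{nonNegative 0≤c}}

0≤* : ∀ {p q} → 0ℚ ≤ p → 0ℚ ≤ q → 0ℚ ≤ p * q
0≤* {p} 0≤p 0≤q = ≤-respˡ (sym (*-zeroʳ p)) (*-monoˡ-≤ 0≤p 0≤q)

*-mono-≤ : ∀ {p q r s} → 0ℚ ≤ q → 0ℚ ≤ r → p ≤ q → r ≤ s → p * r ≤ q * s
*-mono-≤ 0≤q 0≤r p≤q r≤s = ≤-trans (*-monoʳ-≤ 0≤r p≤q) (*-monoˡ-≤ 0≤q r≤s)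

1≤* : ∀ {p q} → 1ℚ ≤ p → 1ℚ ≤ q → 1ℚ ≤ p * q
1≤* 1≤p 1≤q = *-mono-≤ (≤-trans 0≤1 1≤p) 0≤1 1≤p 1≤q

0≤q-p : ∀ {p q} → p ≤ q → 0ℚ ≤ q - p
0≤q-p {p} p≤q = ≤-respˡ (sym (+-inverseʳ p)) (+-monoˡ-≤ (- p) p≤q)

q≡p+z⇒p≤q : ∀ {p q} z → q ≡ p + z → 0ℚ ≤ z → p ≤ q
q≡p+z⇒p≤q {p} z refl 0≤z = ≤-respˡ (sym (+-identityʳ p)) (+-monoʳ-≤ p 0≤z)

p≤∣p∣ : ∀ p → p ≤ ∣ p ∣
p≤∣p∣ p with ≤-total 0ℚ p
... | inj₁ 0≤p = ≤-reflexive (sym (0≤p⇒∣p∣≡p 0≤p))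
... | inj₂ p≤0 = ≤-trans p≤0 (0≤∣p∣ p)

-p≤∣p∣ : ∀ p → - p ≤ ∣ p ∣
-p≤∣p∣ p = ≤-respʳ (∣-p∣≡∣p∣ p) (p≤∣p∣ (- p))

0≤p*p : ∀ p → 0ℚ ≤ p * p
0≤p*p p with ≤-total 0ℚ p
... | inj₁ 0≤p = 0≤* 0≤p 0≤p
... | inj₂ p≤0 = ≤-respʳ (e p) (0≤* (neg-antimono-≤ p≤0) (neg-antimono-≤ p≤0))
  where
  e : ∀ p → - p * - p ≡ p * p
  e = solve-∀ ringℚ

∣p∣*∣p∣≡p*p : ∀ p → ∣ p ∣ * ∣ p ∣ ≡ p * p
∣p∣*∣p∣≡p*p p = trans (sym (∣p*q∣≡∣p∣*∣q∣ p p)) (0≤p⇒∣p∣≡p (0≤p*p p))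

∣p*q∣≤ : ∀ {p q a b} → ∣ p ∣ ≤ a → ∣ q ∣ ≤ b → ∣ p * q ∣ ≤ a * b
∣p*q∣≤ {p} {q} p≤a q≤b = ≤-respˡ (∣p*q∣≡∣p∣*∣q∣ p q)
  (*-mono-≤ (≤-trans (0≤∣p∣ p) p≤a) (0≤∣p∣ q) p≤a q≤b)

∣p+q∣≤ : ∀ {p q a b} → ∣ p ∣ ≤ a → ∣ q ∣ ≤ b → ∣ p + q ∣ ≤ a + b
∣p+q∣≤ {p} {q} p≤a q≤b = ≤-trans (∣p+q∣≤∣p∣+∣q∣ p q) (+-mono-≤ p≤a q≤b)

0≤^ : ∀ {p} n → 0ℚ ≤ p → 0ℚ ≤ p ^ n
0≤^ zero    _   = 0≤1
0≤^ (suc n) 0≤p = 0≤* 0≤p (0≤^ n 0≤p)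

1≤^ : ∀ {p} n → 1ℚ ≤ p → 1ℚ ≤ p ^ n
1≤^ zero    _   = ≤-refl
1≤^ (suc n) 1≤p = 1≤* 1≤p (1≤^ n 1≤p)

1^n≡1 : ∀ n → 1ℚ ^ n ≡ 1ℚ
1^n≡1 zero    = refl
1^n≡1 (suc n) = trans (*-identityˡ (1ℚ ^ n)) (1^n≡1 n)

p*p≤q*q⇒p≤q : ∀ {p q} → 0ℚ ≤ q → p * p ≤ q * q → p ≤ q
p*p≤q*q⇒p≤q {p} {q} 0≤q pp≤qq with p ≤? q
... | yes p≤q = p≤q
... | no p≰q = contradiction (<-≤-trans qq<pp pp≤qq) (<-irrefl refl)
  where
  q<p : q < p
  q<p = ≰⇒> p≰q
  qq<pp : q * q < p * p
  qq<pp = ≤-<-trans (*-monoˡ-≤ 0≤q (<⇒≤ q<p)) (*-monoˡ-<-pos p {{positive (≤-<-trans 0≤q q<p)}} q<p)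

-- Polynomials in one variable

poly : ℕ → (ℕ → ℚ) → ℚ → ℚ
poly zero    a t = a 0
poly (suc r) a t = poly r a t + a (suc r) * t ^ suc r

coeffNorm : ℕ → (ℕ → ℚ) → ℚ
coeffNorm zero    a = ∣ a 0 ∣
coeffNorm (suc r) a = coeffNorm r a + ∣ a (suc r) ∣

coeffNorm-mono : ∀ r {a b} → (∀ j → j ℕ.≤ r → ∣ a j ∣ ≤ ∣ b j ∣) → coeffNorm r a ≤ coeffNorm r b
coeffNorm-mono zero    h = h 0 z≤n
coeffNorm-mono (suc r) h = +-mono-≤ (coeffNorm-mono r (λ j j≤r → h j (ℕ.m≤n⇒m≤1+n j≤r))) (h (suc r) ℕ.≤-refl)

∣t^n∣≤1 : ∀ {t} n → ∣ t ∣ ≤ 1ℚ → ∣ t ^ n ∣ ≤ 1ℚ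
∣t^n∣≤1 zero    _ = ≤-refl
∣t^n∣≤1 (suc n) h = ∣p*q∣≤ h (∣t^n∣≤1 n h)

∣poly∣≤coeffNorm : ∀ r a {t} → ∣ t ∣ ≤ 1ℚ → ∣ poly r a t ∣ ≤ coeffNorm r a
∣poly∣≤coeffNorm zero    a h = ≤-refl
∣poly∣≤coeffNorm (suc r) a h = ∣p+q∣≤ (∣poly∣≤coeffNorm r a h)
  (≤-respʳ (*-identityʳ _) (∣p*q∣≤ {a (suc r)} ≤-refl (∣t^n∣≤1 (suc r) h)))

∣a₁∣≤coeffNorm : ∀ r a → ∣ a 1 ∣ ≤ coeffNorm (suc r) a
∣a₁∣≤coeffNorm zero    a = q≡p+z⇒p≤q ∣ a 0 ∣ (+-comm ∣ a 0 ∣ ∣ a 1 ∣) (0≤∣p∣ (a 0))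
∣a₁∣≤coeffNorm (suc r) a = ≤-trans (∣a₁∣≤coeffNorm r a) (q≡p+z⇒p≤q _ refl (0≤∣p∣ (a (2 ℕ.+ r))))

-- Coefficients of P(t) - l P(t/2): this operator is diagonal on monomials.
dilate : ℚ → (ℕ → ℚ) → ℕ → ℚ
dilate l a j = (1ℚ - l * ½ ^ j) * a j

poly-dilate : ∀ r l a t → poly r a t - l * poly r a (½ * t) ≡ poly r (dilate l a) t
poly-dilate zero    l a t = e l (a 0)
  where
  e : ∀ l x → x - l * x ≡ (1ℚ - l * 1ℚ) * x
  e = solve-∀ ringℚ
poly-dilate (suc r) l a t = begin
  p + x * y - l * (p' + x * (½ * t) ^ suc r)   ≡⟨ cong (λ z → p + x * y - l * (p' + x * z)) (^-distrib-* ½ t (suc r)) ⟩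
  p + x * y - l * (p' + x * (h * y))           ≡⟨ e l p p' x y h ⟩
  (p - l * p') + (1ℚ - l * h) * x * y          ≡⟨ cong (_+ (1ℚ - l * h) * x * y) (poly-dilate r l a t) ⟩
  poly r (dilate l a) t + (1ℚ - l * h) * x * y ∎
  where
  open ≡-Reasoning
  p p' x y h : ℚ
  p  = poly r a t
  p' = poly r a (½ * t)
  x  = a (suc r)
  y  = t ^ suc r
  h  = ½ ^ suc r
  e : ∀ l p p' x y h → p + x * y - l * (p' + x * (h * y)) ≡ (p - l * p') + (1ℚ - l * h) * x * y
  e = solve-∀ ringℚ

2^n*½^n≡1 : ∀ n → 2ℚ ^ n * ½ ^ n ≡ 1ℚ
2^n*½^n≡1 n = trans (sym (^-distrib-* 2ℚ ½ n)) (1^n≡1 n)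

-- This makes each multiplier 1 - l/2ʲ, with l = 2^(r+1) and j ≤ r, at most -1, so that `dilate l`
-- shrinks none of these coefficients.
2≤2^[1+r]*½^j : ∀ {j r} → j ℕ.≤ r → 2ℚ ≤ 2ℚ ^ suc r * ½ ^ j
2≤2^[1+r]*½^j {r = r} z≤n = ≤-respʳ (e (2ℚ ^ r)) (*-monoˡ-≤ 0≤2 (1≤^ r (≤ᵇ⇒≤ _)))
  where
  e : ∀ x → 2ℚ * x ≡ (2ℚ * x) * 1ℚ
  e = solve-∀ ringℚ
2≤2^[1+r]*½^j {suc j} {suc r} (s≤s j≤r) = ≤-respʳ (e (2ℚ ^ suc r) (½ ^ j)) (2≤2^[1+r]*½^j j≤r)
  where
  e : ∀ x y → x * y ≡ (2ℚ * x) * (½ * y)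
  e = solve-∀ ringℚ

-- The recursion adds two estimates, with l = 2^(r+1) and K the constant in degree r: the
-- coefficients below the top one total at most K (1 + l) B, and the top one is at most B more than
-- that.
polyConst : ℕ → ℚ
polyConst zero    = 1ℚ
polyConst (suc r) = 1ℚ + 2ℚ * (polyConst r * (1ℚ + 2ℚ ^ suc r))

1≤polyConst : ∀ r → 1ℚ ≤ polyConst r
1≤polyConst zero    = ≤-refl
1≤polyConst (suc r) = q≡p+z⇒p≤q _ refl
  (0≤* 0≤2 (0≤* (≤-trans 0≤1 (1≤polyConst r)) (0≤+ 0≤1 (0≤^ (suc r) 0≤2))))

-- For P of degree D, the combination P(t) − 2ᴰ P(t/2) cancels the leading coefficient and
-- does not shrink the others in absolute value.
coeffNorm≤ : ∀ r a {B} → (∀ t → 0ℚ ≤ t → t ≤ 1ℚ → ∣ poly r a t ∣ ≤ B) → coeffNorm r a ≤ polyConst r * B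
coeffNorm≤ zero    a {B} h = ≤-respʳ (sym (*-identityˡ B)) (h 0ℚ ≤-refl 0≤1)
coeffNorm≤ (suc r) a {B} h = ≤-respʳ (e₃ (polyConst r) l B) (+-mono-≤ lower top)
  where
  l K : ℚ
  l = 2ℚ ^ suc r
  K = polyConst r
  b : ℕ → ℚ
  b = dilate l a
  e₁ : ∀ q z x → q + 0ℚ * x * z ≡ q
  e₁ = solve-∀ ringℚ
  e₂ : ∀ q x → x ≡ (q + x * 1ℚ) - q
  e₂ = solve-∀ ringℚ
  e₃ : ∀ K l B → K * (B + l * B) + (B + K * (B + l * B)) ≡ (1ℚ + 2ℚ * (K * (1ℚ + l))) * B
  e₃ = solve-∀ ringℚ
  bt : ∀ t → poly r b t ≡ poly (suc r) a t - l * poly (suc r) a (½ * t)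
  bt t = sym (trans (poly-dilate (suc r) l a t)
    (trans (cong (λ z → poly r b t + (1ℚ - z) * a (suc r) * t ^ suc r) (2^n*½^n≡1 (suc r)))
           (e₁ (poly r b t) (t ^ suc r) (a (suc r)))))
  0≤l : 0ℚ ≤ l
  0≤l = 0≤^ (suc r) 0≤2
  -- Halving maps [0,1] into itself, so the hypothesis covers both t and t/2.
  bounded : ∀ t → 0ℚ ≤ t → t ≤ 1ℚ → ∣ poly r b t ∣ ≤ B + l * B
  bounded t 0≤t t≤1 = ≤-respˡ (cong ∣_∣ (bt t))
    (∣p+q∣≤ (h t 0≤t t≤1) (≤-respˡ (∣-p∣≡∣p∣ (l * poly (suc r) a (½ * t)))
      (∣p*q∣≤ (≤-reflexive (0≤p⇒∣p∣≡p 0≤l))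
        (h (½ * t) (0≤* 0≤½ 0≤t) (*-mono-≤ {½} {1ℚ} 0≤1 0≤t (≤ᵇ⇒≤ _) t≤1)))))
  grow : ∀ j → j ℕ.≤ r → ∣ a j ∣ ≤ ∣ b j ∣
  grow j j≤r = ≤-respˡ (sym (*-identityˡ ∣ a j ∣)) (≤-respʳ (sym (∣p*q∣≡∣p∣*∣q∣ (1ℚ - l * ½ ^ j) (a j)))
    (*-monoʳ-≤ (0≤∣p∣ (a j)) (≤-trans 1≤ (-p≤∣p∣ (1ℚ - l * ½ ^ j)))))
    where
    e : ∀ x → - (1ℚ - x) ≡ 1ℚ + (x - 2ℚ)
    e = solve-∀ ringℚ
    1≤ : 1ℚ ≤ - (1ℚ - l * ½ ^ j)
    1≤ = q≡p+z⇒p≤q _ (e (l * ½ ^ j)) (0≤q-p (2≤2^[1+r]*½^j j≤r))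
  lower : coeffNorm r a ≤ K * (B + l * B)
  lower = ≤-trans (coeffNorm-mono r grow) (coeffNorm≤ r b bounded)
  P[1] : ∣ poly r a 1ℚ + a (suc r) * 1ℚ ∣ ≤ B
  P[1] = ≤-respˡ (cong (λ z → ∣ poly r a 1ℚ + a (suc r) * z ∣) (sym (1^n≡1 (suc r)))) (h 1ℚ 0≤1 ≤-refl)
  -- The top coefficient is P(1) minus the sum of the others.
  top : ∣ a (suc r) ∣ ≤ B + K * (B + l * B)
  top = ≤-respˡ (cong ∣_∣ (e₂ (poly r a 1ℚ) (a (suc r))))
    (∣p+q∣≤ P[1] (≤-respˡ (∣-p∣≡∣p∣ (poly r a 1ℚ)) (≤-trans (∣poly∣≤coeffNorm r a ≤-refl) lower)))

-- Homogeneous multilinear forms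

lo hi : ∀ {n} {A : Set} → (Subset (suc n) → A) → Subset n → A
lo w e = w (outside ∷ e)
hi w e = w (inside ∷ e)

-- form r w x = Σ_{|e| = r} w(e) Π_{i ∈ e} x_i
form : ∀ {n} → ℕ → (Subset n → ℚ) → Vector ℚ n → ℚ
form         zero    w x = w ⊥
form {zero}  (suc r) w x = 0ℚ
form {suc n} (suc r) w x = form (suc r) (lo w) (tail x) + x zero * form r (hi w) (tail x)

form-cong : ∀ {n} r {v w : Subset n → ℚ} x → (∀ e → v e ≡ w e) → form r v x ≡ form r w x
form-cong         zero    x h = h ⊥
form-cong {zero}  (suc r) x h = refl
form-cong {suc n} (suc r) x h = cong₂ (λ p q → p + x zero * q)
  (form-cong (suc r) (tail x) (h ∘ (outside ∷_))) (form-cong r (tail x) (h ∘ (inside ∷_)))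

form-congˣ : ∀ {n} r (w : Subset n → ℚ) {x y} → (∀ i → x i ≡ y i) → form r w x ≡ form r w y
form-congˣ         zero    w h = refl
form-congˣ {zero}  (suc r) w h = refl
form-congˣ {suc n} (suc r) w h = cong₂ _+_ (form-congˣ (suc r) (lo w) (h ∘ suc))
  (cong₂ _*_ (h zero) (form-congˣ r (hi w) (h ∘ suc)))

form-+ : ∀ {n} r (v w : Subset n → ℚ) x → form r (λ e → v e + w e) x ≡ form r v x + form r w x
form-+         zero    v w x = refl
form-+ {zero}  (suc r) v w x = refl
form-+ {suc n} (suc r) v w x = trans
  (cong₂ (λ p q → p + x zero * q) (form-+ (suc r) (lo v) (lo w) (tail x))
                                  (form-+ r (hi v) (hi w) (tail x)))
  (e (form (suc r) (lo v) (tail x)) (form (suc r) (lo w) (tail x)) (form r (hi v) (tail x)) (form r (hi w) (tail x)) (x zero))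
  where
  e : ∀ a b c d t → (a + b) + t * (c + d) ≡ (a + t * c) + (b + t * d)
  e = solve-∀ ringℚ

form-* : ∀ {n} r c (w : Subset n → ℚ) x → form r (λ e → c * w e) x ≡ c * form r w x
form-*         zero    c w x = refl
form-* {zero}  (suc r) c w x = sym (*-zeroʳ c)
form-* {suc n} (suc r) c w x = trans
  (cong₂ (λ p q → p + x zero * q) (form-* (suc r) c (lo w) (tail x))
                                  (form-* r c (hi w) (tail x)))
  (e (form (suc r) (lo w) (tail x)) (form r (hi w) (tail x)) c (x zero))
  where
  e : ∀ a b c t → c * a + t * (c * b) ≡ c * (a + t * b)
  e = solve-∀ ringℚ

form-0 : ∀ {n} r (x : Vector ℚ n) → form r (const 0ℚ) x ≡ 0ℚ
form-0         zero    x = refl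
form-0 {zero}  (suc r) x = refl
form-0 {suc n} (suc r) x = trans (cong₂ (λ p q → p + x zero * q) (form-0 (suc r) (tail x)) (form-0 r (tail x))) (e (x zero))
  where
  e : ∀ t → 0ℚ + t * 0ℚ ≡ 0ℚ
  e = solve-∀ ringℚ

form-homogeneous : ∀ {n} r c (w : Subset n → ℚ) x → form r w (λ i → c * x i) ≡ c ^ r * form r w x
form-homogeneous         zero    c w x = sym (*-identityˡ (w ⊥))
form-homogeneous {zero}  (suc r) c w x = sym (*-zeroʳ (c ^ suc r))
form-homogeneous {suc n} (suc r) c w x = trans
  (cong₂ (λ p q → p + c * x zero * q) (form-homogeneous (suc r) c (lo w) (tail x))
                                      (form-homogeneous r c (hi w) (tail x)))
  (e (form (suc r) (lo w) (tail x)) (form r (hi w) (tail x)) c (c ^ r) (x zero))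
  where
  e : ∀ a b c d t → c * d * a + c * t * (d * b) ≡ c * d * (a + t * b)
  e = solve-∀ ringℚ

form-nonNeg : ∀ {n} r {w : Subset n → ℚ} {x} → (∀ e → 0ℚ ≤ w e) → (∀ i → 0ℚ ≤ x i) → 0ℚ ≤ form r w x
form-nonNeg         zero    hw hx = hw ⊥
form-nonNeg {zero}  (suc r) hw hx = ≤-refl
form-nonNeg {suc n} (suc r) hw hx = 0≤+ (form-nonNeg (suc r) (hw ∘ (outside ∷_)) (hx ∘ suc))
  (0≤* (hx zero) (form-nonNeg r (hw ∘ (inside ∷_)) (hx ∘ suc)))

-- Restricting one variable of a homogeneous form breaks homogeneity, so the passage from
-- {0,1}ⁿ to [0,1]ⁿ is made with arbitrary multilinear polynomials.
multilinear : ∀ {n} → (Subset n → ℚ) → Vector ℚ n → ℚ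
multilinear {zero}  w x = w []
multilinear {suc n} w x = multilinear (lo w) (tail x) + x zero * multilinear (hi w) (tail x)

multilinear-0 : ∀ {n} (x : Vector ℚ n) → multilinear (const 0ℚ) x ≡ 0ℚ
multilinear-0 {zero}  x = refl
multilinear-0 {suc n} x = trans (cong₂ (λ p q → p + x zero * q) (multilinear-0 (tail x)) (multilinear-0 (tail x))) (e (x zero))
  where
  e : ∀ t → 0ℚ + t * 0ℚ ≡ 0ℚ
  e = solve-∀ ringℚ

multilinear-+* : ∀ {n} c (v w : Subset n → ℚ) x → multilinear (λ e → v e + c * w e) x ≡ multilinear v x + c * multilinear w x
multilinear-+* {zero}  c v w x = refl
multilinear-+* {suc n} c v w x = trans
  (cong₂ (λ p q → p + x zero * q) (multilinear-+* c (lo v) (lo w) (tail x))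
                                  (multilinear-+* c (hi v) (hi w) (tail x)))
  (e (multilinear (lo v) (tail x)) (multilinear (lo w) (tail x)) (multilinear (hi v) (tail x)) (multilinear (hi w) (tail x)) c (x zero))
  where
  e : ∀ a b d f c t → (a + c * b) + t * (d + c * f) ≡ (a + t * d) + c * (b + t * f)
  e = solve-∀ ringℚ

layer : ∀ {n} → ℕ → (Subset n → ℚ) → Subset n → ℚ
layer r w e = if Sub.∣ e ∣ ≡ᵇ r then w e else 0ℚ

form≡multilinear : ∀ {n} r (w : Subset n → ℚ) x → form r w x ≡ multilinear (layer r w) x
form≡multilinear {zero}  zero    w x = refl
form≡multilinear {zero}  (suc r) w x = refl
form≡multilinear {suc n} zero    w x = trans (e (w ⊥) (x zero))
  (cong₂ (λ p q → p + x zero * q) (form≡multilinear zero (lo w) (tail x)) (sym (multilinear-0 (tail x))))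
  where
  e : ∀ a t → a ≡ a + t * 0ℚ
  e = solve-∀ ringℚ
form≡multilinear {suc n} (suc r) w x = cong₂ (λ p q → p + x zero * q)
  (form≡multilinear (suc r) (lo w) (tail x)) (form≡multilinear r (hi w) (tail x))

χ : ∀ {n} → Subset n → Vector ℚ n
χ U i = if lookup U i then 1ℚ else 0ℚ

-- The polynomial is affine in its first variable, so its value at c in [0,1] is a convex
-- combination of the values at 0 and 1. Freezing that variable at c leaves a multilinear polynomial
-- with coefficients `w₀ e + c * w₁ e`, which inherits the bound at the vertices.
multilinear-hull : ∀ {n} (w : Subset n → ℚ) {M} → (∀ U → ∣ multilinear w (χ U) ∣ ≤ M) →
  ∀ x → (∀ i → 0ℚ ≤ x i) → (∀ i → x i ≤ 1ℚ) → ∣ multilinear w x ∣ ≤ M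
multilinear-hull {zero}  w h x 0≤x x≤1 = h []
multilinear-hull {suc n} w {M} h x 0≤x x≤1 = ≤-respˡ (cong ∣_∣ (sym (multilinear-+* c w₀ w₁ (tail x))))
  (multilinear-hull (λ e → w₀ e + c * w₁ e) bound (tail x) (0≤x ∘ suc) (x≤1 ∘ suc))
  where
  c : ℚ
  c = x zero
  w₀ w₁ : Subset n → ℚ
  w₀ = lo w
  w₁ = hi w
  e₁ : ∀ c p q → p + c * q ≡ (1ℚ - c) * (p + 0ℚ * q) + c * (p + 1ℚ * q)
  e₁ = solve-∀ ringℚ
  e₂ : ∀ c M → (1ℚ - c) * M + c * M ≡ M
  e₂ = solve-∀ ringℚ
  bound : ∀ U → ∣ multilinear (λ e → w₀ e + c * w₁ e) (χ U) ∣ ≤ M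
  bound U = ≤-respˡ (cong ∣_∣ (trans (multilinear-+* c w₀ w₁ (χ U)) (e₁ c (multilinear w₀ (χ U)) (multilinear w₁ (χ U)))))
    (≤-respʳ (e₂ c M) (∣p+q∣≤
      (∣p*q∣≤ (≤-reflexive (0≤p⇒∣p∣≡p (0≤q-p (x≤1 zero)))) (h (outside ∷ U)))
      (∣p*q∣≤ (≤-reflexive (0≤p⇒∣p∣≡p (0≤x zero))) (h (inside ∷ U)))))

form-hull : ∀ {n} r (w : Subset n → ℚ) {M} → (∀ U → ∣ form r w (χ U) ∣ ≤ M) →
  ∀ x → (∀ i → 0ℚ ≤ x i) → (∀ i → x i ≤ 1ℚ) → ∣ form r w x ∣ ≤ M
form-hull r w h x 0≤x x≤1 = ≤-respˡ (cong ∣_∣ (form≡multilinear r w x))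
  (multilinear-hull (layer r w) (λ U → ≤-respˡ (cong ∣_∣ (sym (form≡multilinear r w (χ U)))) (h U)) x 0≤x x≤1)

-- Partial derivatives and Taylor coefficients along a line

-- Sets containing i get weight 0, and a set e without i gets the weight of e ∪ {i}. The index set
-- is unchanged, so all derivatives are forms in the same n variables.
∂ : ∀ {n} → Fin n → (Subset n → ℚ) → Subset n → ℚ
∂ zero    w (outside ∷ e) = w (inside ∷ e)
∂ zero    w (inside ∷ e)  = 0ℚ
∂ (suc y) w (b ∷ e)       = ∂ y (w ∘ (b ∷_)) e

form-∂zero : ∀ {n} r (w : Subset (suc n) → ℚ) x → form r (∂ zero w) x ≡ form r (hi w) (tail x)
form-∂zero zero    w x = refl
form-∂zero (suc r) w x = trans (cong (λ q → form (suc r) (hi w) (tail x) + x zero * q) (form-0 r (tail x)))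
  (e _ (x zero))
  where
  e : ∀ a t → a + t * 0ℚ ≡ a
  e = solve-∀ ringℚ

shift : (ℕ → ℚ) → ℕ → ℚ
shift a zero    = 0ℚ
shift a (suc j) = a j

-- the coefficient of tʲ in form r w (x + t y)
taylor : ∀ {n} → ℕ → (Subset n → ℚ) → (x y : Vector ℚ n) → ℕ → ℚ
taylor         zero    w x y zero    = w ⊥
taylor         zero    w x y (suc j) = 0ℚ
taylor {zero}  (suc r) w x y j = 0ℚ
taylor {suc n} (suc r) w x y j = taylor (suc r) (lo w) (tail x) (tail y) j
  + (x zero * taylor r (hi w) (tail x) (tail y) j + y zero * shift (taylor r (hi w) (tail x) (tail y)) j)

taylor-degree : ∀ {n} r (w : Subset n → ℚ) x y {j} → r ℕ.< j → taylor r w x y j ≡ 0ℚ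
taylor-degree         zero    w x y (s≤s _) = refl
taylor-degree {zero}  (suc r) w x y _ = refl
taylor-degree {suc n} (suc r) w x y {suc j} (s≤s r<j) = trans
  (cong₂ _+_ (taylor-degree (suc r) (lo w) (tail x) (tail y) (s≤s r<j))
    (cong₂ (λ p q → x zero * p + y zero * q) (taylor-degree r (hi w) (tail x) (tail y) (ℕ.m≤n⇒m≤1+n r<j))
                                          (taylor-degree r (hi w) (tail x) (tail y) r<j)))
  (e (x zero) (y zero))
  where
  e : ∀ s t → 0ℚ + (s * 0ℚ + t * 0ℚ) ≡ 0ℚ
  e = solve-∀ ringℚ

poly-0 : ∀ r t → poly r (const 0ℚ) t ≡ 0ℚ
poly-0 zero    t = refl
poly-0 (suc r) t = trans (cong₂ _+_ (poly-0 r t) (*-zeroˡ (t ^ suc r))) refl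

poly-shift : ∀ r a t → poly (suc r) (shift a) t ≡ t * poly r a t
poly-shift zero    a t = e (a 0) t
  where
  e : ∀ a t → 0ℚ + a * (t * 1ℚ) ≡ t * a
  e = solve-∀ ringℚ
poly-shift (suc r) a t = trans (cong (_+ a (suc r) * t ^ (2 ℕ.+ r)) (poly-shift r a t)) (e t _ (a (suc r)) (t ^ suc r))
  where
  e : ∀ t p a s → t * p + a * (t * s) ≡ t * (p + a * s)
  e = solve-∀ ringℚ

poly-linear : ∀ r a b c s u t → poly r (λ j → a j + (s * b j + u * c j)) t ≡ poly r a t + (s * poly r b t + u * poly r c t)
poly-linear zero    a b c s u t = refl
poly-linear (suc r) a b c s u t = trans (cong (_+ (a (suc r) + (s * b (suc r) + u * c (suc r))) * t ^ suc r) (poly-linear r a b c s u t))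
  (e (poly r a t) (poly r b t) (poly r c t) (a (suc r)) (b (suc r)) (c (suc r)) s u (t ^ suc r))
  where
  e : ∀ p q o a b c s u t → (p + (s * q + u * o)) + (a + (s * b + u * c)) * t
    ≡ (p + a * t) + (s * (q + b * t) + u * (o + c * t))
  e = solve-∀ ringℚ

form-taylor : ∀ {n} r (w : Subset n → ℚ) x y t → form r w (λ i → x i + t * y i) ≡ poly r (taylor r w x y) t
form-taylor         zero    w x y t = refl
form-taylor {zero}  (suc r) w x y t = sym (poly-0 (suc r) t)
form-taylor {suc n} (suc r) w x y t = begin
  form (suc r) w₀ xt + (x zero + t * y zero) * form r w₁ xt
    ≡⟨ cong₂ (λ p q → p + (x zero + t * y zero) * q) (form-taylor (suc r) w₀ (tail x) (tail y) t) (form-taylor r w₁ (tail x) (tail y) t) ⟩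
  p₀ + (x zero + t * y zero) * p₁
    ≡⟨ e p₀ p₁ (x zero) t (y zero) (t ^ suc r) ⟩
  -- `p₁` has degree r and `p₀` degree r + 1. A zero term pads `p₁`, and `taylor-degree` identifies
  -- that zero with coefficient r + 1 of `a₁`.
  p₀ + (x zero * (p₁ + 0ℚ * t ^ suc r) + y zero * (t * p₁))
    ≡⟨ cong₂ (λ z q → p₀ + (x zero * (p₁ + z * t ^ suc r) + y zero * q))
             (sym (taylor-degree r w₁ (tail x) (tail y) (ℕ.n<1+n r))) (sym (poly-shift r a₁ t)) ⟩
  p₀ + (x zero * poly (suc r) a₁ t + y zero * poly (suc r) (shift a₁) t)
    ≡⟨ sym (poly-linear (suc r) a₀ a₁ (shift a₁) (x zero) (y zero) t) ⟩
  poly (suc r) (taylor (suc r) w x y) t ∎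
  where
  open ≡-Reasoning
  w₀ w₁ : Subset n → ℚ
  w₀ = lo w
  w₁ = hi w
  xt : Vector ℚ n
  xt i = x (suc i) + t * y (suc i)
  a₀ a₁ : ℕ → ℚ
  a₀ = taylor (suc r) w₀ (tail x) (tail y)
  a₁ = taylor r w₁ (tail x) (tail y)
  p₀ p₁ : ℚ
  p₀ = poly (suc r) a₀ t
  p₁ = poly r a₁ t
  e : ∀ p₀ p₁ x t y s → p₀ + (x + t * y) * p₁ ≡ p₀ + (x * (p₁ + 0ℚ * s) + y * (t * p₁))
  e = solve-∀ ringℚ

taylor-0 : ∀ {n} r (w : Subset n → ℚ) x y → taylor r w x y 0 ≡ form r w x
taylor-0         zero    w x y = refl
taylor-0 {zero}  (suc r) w x y = refl
taylor-0 {suc n} (suc r) w x y = trans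
  (cong₂ (λ p q → p + (x zero * q + y zero * 0ℚ)) (taylor-0 (suc r) (lo w) (tail x) (tail y)) (taylor-0 r (hi w) (tail x) (tail y)))
  (e (form (suc r) (lo w) (tail x)) (form r (hi w) (tail x)) (x zero) (y zero))
  where
  e : ∀ p q s t → p + (s * q + t * 0ℚ) ≡ p + s * q
  e = solve-∀ ringℚ

sum-form-∂suc : ∀ {n} r (w : Subset (suc n) → ℚ) x (y : Vector ℚ n) →
  sum (λ i → y i * form (suc r) (∂ (suc i) w) x)
  ≡ sum (λ i → y i * form (suc r) (∂ i (lo w)) (tail x)) + x zero * sum (λ i → y i * form r (∂ i (hi w)) (tail x))
sum-form-∂suc {n} r w x y = begin
  sum (λ i → y i * (p i + x zero * q i))               ≡⟨ sum-cong-≗ (λ i → e (y i) (p i) (q i) (x zero)) ⟩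
  sum (λ i → y i * p i + x zero * (y i * q i))         ≡⟨ ∑-distrib-+ (λ i → y i * p i) (λ i → x zero * (y i * q i)) ⟩
  sum (λ i → y i * p i) + sum (λ i → x zero * (y i * q i))
    ≡⟨ cong (sum (λ i → y i * p i) +_) (sym (*-distribˡ-sum (x zero) (λ i → y i * q i))) ⟩
  sum (λ i → y i * p i) + x zero * sum (λ i → y i * q i) ∎
  where
  open ≡-Reasoning
  p q : Vector ℚ n
  p i = form (suc r) (∂ i (lo w)) (tail x)
  q i = form r (∂ i (hi w)) (tail x)
  e : ∀ y p q x → y * (p + x * q) ≡ y * p + x * (y * q)
  e = solve-∀ ringℚ

-- The directional derivative along y, by the product rule for (x₀ + t y₀) times the `hi` part: y₀
-- meets the constant coefficient, which is the derivative in the first variable, and x₀ meets the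
-- linear one, which is covered by induction.
taylor-1 : ∀ {n} r (w : Subset n → ℚ) x y → taylor (suc r) w x y 1 ≡ sum (λ i → y i * form r (∂ i w) x)
taylor-1 {zero}  r w x y = refl
taylor-1 {suc n} zero w x y = trans
  (cong (λ p → p + (x zero * 0ℚ + y zero * w₁ ⊥)) (taylor-1 zero w₀ (tail x) (tail y)))
  (e _ (x zero) (y zero * w₁ ⊥))
  where
  w₀ w₁ : Subset n → ℚ
  w₀ = lo w
  w₁ = hi w
  e : ∀ p x q → p + (x * 0ℚ + q) ≡ q + p
  e = solve-∀ ringℚ
taylor-1 {suc n} (suc r) w x y = begin
  taylor (2 ℕ.+ r) w₀ (tail x) (tail y) 1 + (x zero * taylor (suc r) w₁ (tail x) (tail y) 1 + y zero * taylor (suc r) w₁ (tail x) (tail y) 0)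
    ≡⟨ cong₂ _+_ (taylor-1 (suc r) w₀ (tail x) (tail y)) (cong₂ (λ p q → x zero * p + y zero * q) (taylor-1 r w₁ (tail x) (tail y)) (taylor-0 (suc r) w₁ (tail x) (tail y))) ⟩
  s₀ + (x zero * s₁ + y zero * form (suc r) w₁ (tail x))
    ≡⟨ e s₀ (x zero * s₁) (y zero * form (suc r) w₁ (tail x)) ⟩
  y zero * form (suc r) w₁ (tail x) + (s₀ + x zero * s₁)
    ≡⟨ cong₂ (λ p q → y zero * p + q) (sym (form-∂zero (suc r) w x)) (sym (sum-form-∂suc r w x (tail y))) ⟩
  sum (λ i → y i * form (suc r) (∂ i w) x) ∎
  where
  open ≡-Reasoning
  w₀ w₁ : Subset n → ℚ
  w₀ = lo w
  w₁ = hi w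
  s₀ s₁ : ℚ
  s₀ = sum (λ i → y (suc i) * form (suc r) (∂ i w₀) (tail x))
  s₁ = sum (λ i → y (suc i) * form r (∂ i w₁) (tail x))
  e : ∀ a b c → a + (b + c) ≡ c + (a + b)
  e = solve-∀ ringℚ

-- Bounds on the cube [-1,1]ⁿ and on the gradient

-- On the line x + (1 + t)(1,...,1) the parameters t in [0,1] give points of [0,3]ⁿ, where
-- homogeneity yields the bound 3ʳ M. This controls all coefficients in t, and hence the value at t
-- = -1, which is the point x.
form-hull± : ∀ {n} r (w : Subset n → ℚ) {M} → (∀ U → ∣ form r w (χ U) ∣ ≤ M) →
  ∀ x → (∀ i → ∣ x i ∣ ≤ 1ℚ) → ∣ form r w x ∣ ≤ polyConst r * (3ℚ ^ r * M)
form-hull± {n} r w {M} h x ∣x∣≤1 = ≤-respˡ (cong ∣_∣ (trans (form-congˣ r w (λ i → e₁ (x i))) (form-taylor r w a (const 1ℚ) (- 1ℚ))))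
  (≤-trans (∣poly∣≤coeffNorm r (taylor r w a (const 1ℚ)) ≤-refl) (coeffNorm≤ r (taylor r w a (const 1ℚ)) bounded))
  where
  ⅓ : ℚ
  ⅓ = ℤ.+ 1 / 3
  a : Vector ℚ n
  a i = x i + 1ℚ
  e₁ : ∀ x → x ≡ x + 1ℚ + - 1ℚ * 1ℚ
  e₁ = solve-∀ ringℚ
  e₂ : ∀ x t → x + 1ℚ + t * 1ℚ ≡ 3ℚ * (⅓ * (x + 1ℚ + t))
  e₂ = solve-∀ ringℚ
  e₃ : ∀ x → 1ℚ - - x ≡ x + 1ℚ
  e₃ = solve-∀ ringℚ
  e₄ : ∀ x t → 1ℚ ≡ ⅓ * (x + 1ℚ + t) + ⅓ * ((1ℚ - x) + (1ℚ - t))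
  e₄ = solve-∀ ringℚ
  0≤⅓ : 0ℚ ≤ ⅓
  0≤⅓ = ≤ᵇ⇒≤ _
  bounded : ∀ t → 0ℚ ≤ t → t ≤ 1ℚ → ∣ poly r (taylor r w a (const 1ℚ)) t ∣ ≤ 3ℚ ^ r * M
  bounded t 0≤t t≤1 = ≤-respˡ
    (cong ∣_∣ (trans (sym (form-taylor r w a (const 1ℚ) t))
              (trans (form-congˣ r w (λ i → e₂ (x i) t)) (form-homogeneous r 3ℚ w z))))
    (∣p*q∣≤ (≤-reflexive (0≤p⇒∣p∣≡p (0≤^ r 0≤3))) (form-hull r w h z
      (λ i → 0≤* 0≤⅓ (0≤+ (≤-respʳ (e₃ (x i)) (0≤q-p (≤-trans (-p≤∣p∣ (x i)) (∣x∣≤1 i)))) 0≤t))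
      (λ i → q≡p+z⇒p≤q _ (e₄ (x i) t) (0≤* 0≤⅓ (0≤+ (0≤q-p (≤-trans (p≤∣p∣ (x i)) (∣x∣≤1 i))) (0≤q-p t≤1))))))
    where
    z : Vector ℚ n
    z i = ⅓ * (x i + 1ℚ + t)

signOf : ℚ → ℚ
signOf p with ≤-total 0ℚ p
... | inj₁ _ = 1ℚ
... | inj₂ _ = - 1ℚ

∣signOf∣≤1 : ∀ p → ∣ signOf p ∣ ≤ 1ℚ
∣signOf∣≤1 p with ≤-total 0ℚ p
... | inj₁ _ = ≤-refl
... | inj₂ _ = ≤-refl

signOf*p≡∣p∣ : ∀ p → signOf p * p ≡ ∣ p ∣
signOf*p≡∣p∣ p with ≤-total 0ℚ p
... | inj₁ 0≤p = trans (*-identityˡ p) (sym (0≤p⇒∣p∣≡p 0≤p))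
... | inj₂ p≤0 = trans (e p) (trans (sym (0≤p⇒∣p∣≡p (neg-antimono-≤ p≤0))) (∣-p∣≡∣p∣ p))
  where
  e : ∀ p → - 1ℚ * p ≡ - p
  e = solve-∀ ringℚ

-- In the direction y of the signs of the partial derivatives, the directional derivative is the sum
-- of their absolute values. It is the linear coefficient along x + t y, a line that stays in
-- [-2,2]ⁿ for t in [0,1]; homogeneity then costs the factor 2^(r+1).
gradient-bound : ∀ {n} r (w : Subset n → ℚ) {B} → (∀ x → (∀ i → ∣ x i ∣ ≤ 1ℚ) → ∣ form (suc r) w x ∣ ≤ B) →
  ∀ x → (∀ i → ∣ x i ∣ ≤ 1ℚ) → sum (λ i → ∣ form r (∂ i w) x ∣) ≤ polyConst (suc r) * (2ℚ ^ suc r * B)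
gradient-bound {n} r w {B} h x ∣x∣≤1 = ≤-respˡ
  (trans (sum-cong-≗ (λ i → sym (signOf*p≡∣p∣ (form r (∂ i w) x)))) (sym (taylor-1 r w x y)))
  (≤-trans (p≤∣p∣ _) (≤-trans (∣a₁∣≤coeffNorm r (taylor (suc r) w x y)) (coeffNorm≤ (suc r) (taylor (suc r) w x y) bounded)))
  where
  y : Vector ℚ n
  y i = signOf (form r (∂ i w) x)
  e₁ : ∀ x t y → x + t * y ≡ 2ℚ * (½ * (x + t * y))
  e₁ = solve-∀ ringℚ
  bounded : ∀ t → 0ℚ ≤ t → t ≤ 1ℚ → ∣ poly (suc r) (taylor (suc r) w x y) t ∣ ≤ 2ℚ ^ suc r * B
  bounded t 0≤t t≤1 = ≤-respˡ
    (cong ∣_∣ (trans (sym (form-taylor (suc r) w x y t))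
              (trans (form-congˣ (suc r) w (λ i → e₁ (x i) t (y i))) (form-homogeneous (suc r) 2ℚ w z))))
    (∣p*q∣≤ (≤-reflexive (0≤p⇒∣p∣≡p (0≤^ (suc r) 0≤2))) (h z
      (λ i → ∣p*q∣≤ {½} {b = 2ℚ} ≤-refl
        (∣p+q∣≤ (∣x∣≤1 i) (∣p*q∣≤ (≤-respˡ (0≤p⇒∣p∣≡p 0≤t) t≤1) (∣signOf∣≤1 (form r (∂ i w) x)))))))
    where
    z : Vector ℚ n
    z i = ½ * (x i + t * y i)

gradConst : ℕ → ℚ
gradConst r = polyConst (suc r) * (2ℚ ^ suc r * (polyConst (suc r) * 3ℚ ^ suc r))

sum-∣∂∣≤ : ∀ {n} r (w : Subset n → ℚ) {M} → (∀ U → ∣ form (suc r) w (χ U) ∣ ≤ M) →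
  ∀ x → (∀ i → ∣ x i ∣ ≤ 1ℚ) → sum (λ i → ∣ form r (∂ i w) x ∣) ≤ gradConst r * M
sum-∣∂∣≤ r w {M} h x ∣x∣≤1 = ≤-respʳ (e (polyConst (suc r)) (2ℚ ^ suc r) (3ℚ ^ suc r) M)
  (gradient-bound r w (form-hull± (suc r) w h) x ∣x∣≤1)
  where
  e : ∀ K a b M → K * (a * (K * (b * M))) ≡ (K * (a * (K * b))) * M
  e = solve-∀ ringℚ

-- Averages over {-1,1}ⁿ

avg : ∀ {n} → (Vector ℚ n → ℚ) → ℚ
avg {zero}  g = g Vector.[]
avg {suc n} g = ½ * (avg (λ x → g (1ℚ Vector.∷ x)) + avg (λ x → g (- 1ℚ Vector.∷ x)))

-- The comparison is asked for only inside the cube, because the gradient bound is available only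
-- there.
avg-mono : ∀ {n} {g h : Vector ℚ n → ℚ} → (∀ x → (∀ i → ∣ x i ∣ ≤ 1ℚ) → g x ≤ h x) → avg g ≤ avg h
avg-mono {zero}  g≤h = g≤h Vector.[] (λ ())
avg-mono {suc n} g≤h = *-monoˡ-≤ 0≤½ (+-mono-≤
  (avg-mono (λ x ∣x∣≤1 → g≤h (1ℚ Vector.∷ x) λ { zero → ≤-refl ; (suc i) → ∣x∣≤1 i }))
  (avg-mono (λ x ∣x∣≤1 → g≤h (- 1ℚ Vector.∷ x) λ { zero → ≤-refl ; (suc i) → ∣x∣≤1 i })))

avg-cong : ∀ {n} {g h : Vector ℚ n → ℚ} → (∀ x → g x ≡ h x) → avg g ≡ avg h
avg-cong {zero}  g≡h = g≡h Vector.[]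
avg-cong {suc n} g≡h = cong₂ (λ p q → ½ * (p + q)) (avg-cong (λ x → g≡h (1ℚ Vector.∷ x))) (avg-cong (λ x → g≡h (- 1ℚ Vector.∷ x)))

avg-+ : ∀ {n} (g h : Vector ℚ n → ℚ) → avg (λ x → g x + h x) ≡ avg g + avg h
avg-+ {zero}  g h = refl
avg-+ {suc n} g h = trans (cong₂ (λ p q → ½ * (p + q)) (avg-+ g₊ h₊) (avg-+ g₋ h₋)) (e (avg g₊) (avg h₊) (avg g₋) (avg h₋))
  where
  g₊ g₋ h₊ h₋ : Vector ℚ n → ℚ
  g₊ x = g (1ℚ Vector.∷ x)
  g₋ x = g (- 1ℚ Vector.∷ x)
  h₊ x = h (1ℚ Vector.∷ x)
  h₋ x = h (- 1ℚ Vector.∷ x)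
  e : ∀ a b c d → ½ * ((a + b) + (c + d)) ≡ ½ * (a + c) + ½ * (b + d)
  e = solve-∀ ringℚ

avg-* : ∀ {n} c (g : Vector ℚ n → ℚ) → avg (λ x → c * g x) ≡ c * avg g
avg-* {zero}  c g = refl
avg-* {suc n} c g = trans (cong₂ (λ p q → ½ * (p + q)) (avg-* c (λ x → g (1ℚ Vector.∷ x))) (avg-* c (λ x → g (- 1ℚ Vector.∷ x))))
  (e c (avg (λ x → g (1ℚ Vector.∷ x))) (avg (λ x → g (- 1ℚ Vector.∷ x))))
  where
  e : ∀ c a b → ½ * (c * a + c * b) ≡ c * (½ * (a + b))
  e = solve-∀ ringℚ

avg-const : ∀ {n} c → avg {n} (const c) ≡ c
avg-const {zero}  c = refl
avg-const {suc n} c = trans (cong₂ (λ p q → ½ * (p + q)) (avg-const {n} c) (avg-const {n} c)) (e c)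
  where
  e : ∀ c → ½ * (c + c) ≡ c
  e = solve-∀ ringℚ

avg-sum : ∀ {m n} (g : Fin m → Vector ℚ n → ℚ) → avg (λ x → sum (λ i → g i x)) ≡ sum (λ i → avg (g i))
avg-sum {zero}  {n} g = avg-const {n} 0ℚ
avg-sum {suc m} g = trans (avg-+ (g zero) (λ x → sum (λ i → g (suc i) x))) (cong (avg (g zero) +_) (avg-sum (g ∘ suc)))

-- Pairing the two values of the first sign under the average lets the terms odd in it cancel
-- pointwise.
avg-suc : ∀ {n} (g : Vector ℚ (suc n) → ℚ) → avg g ≡ avg (λ x → ½ * (g (1ℚ Vector.∷ x) + g (- 1ℚ Vector.∷ x)))
avg-suc g = sym (trans (avg-* ½ (λ x → g (1ℚ Vector.∷ x) + g (- 1ℚ Vector.∷ x))) (cong (½ *_) (avg-+ (λ x → g (1ℚ Vector.∷ x)) (λ x → g (- 1ℚ Vector.∷ x)))))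

normSq : ∀ {n} → ℕ → (Subset n → ℚ) → ℚ
normSq r w = form r (λ e → w e * w e) (const 1ℚ)

0≤normSq : ∀ {n} r (w : Subset n → ℚ) → 0ℚ ≤ normSq r w
0≤normSq r w = form-nonNeg r (λ e → 0≤p*p (w e)) (λ _ → 0≤1)

-- Parseval's identity: the cross terms ± 2 f g cancel between the two values of the first sign.
avg-form² : ∀ {n} r (w : Subset n → ℚ) → avg (λ x → form r w x * form r w x) ≡ normSq r w
avg-form² {n}     zero    w = avg-const {n} (w ⊥ * w ⊥)
avg-form² {zero}  (suc r) w = refl
avg-form² {suc n} (suc r) w = begin
  avg (λ x → form (suc r) w x * form (suc r) w x)        ≡⟨ avg-suc (λ x → form (suc r) w x * form (suc r) w x) ⟩
  avg (λ x → ½ * ((f x + 1ℚ * g x) * (f x + 1ℚ * g x) + (f x + - 1ℚ * g x) * (f x + - 1ℚ * g x)))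
                                                         ≡⟨ avg-cong (λ x → e (f x) (g x)) ⟩
  avg (λ x → f x * f x + 1ℚ * (g x * g x))               ≡⟨ avg-+ (λ x → f x * f x) (λ x → 1ℚ * (g x * g x)) ⟩
  avg (λ x → f x * f x) + avg (λ x → 1ℚ * (g x * g x))   ≡⟨ cong (avg (λ x → f x * f x) +_) (avg-* 1ℚ (λ x → g x * g x)) ⟩
  avg (λ x → f x * f x) + 1ℚ * avg (λ x → g x * g x)     ≡⟨ cong₂ (λ p q → p + 1ℚ * q) (avg-form² (suc r) (lo w)) (avg-form² r (hi w)) ⟩
  normSq (suc r) w ∎
  where
  open ≡-Reasoning
  f g : Vector ℚ n → ℚ
  f = form (suc r) (lo w)
  g = form r (hi w)
  e : ∀ f g → ½ * ((f + 1ℚ * g) * (f + 1ℚ * g) + (f + - 1ℚ * g) * (f + - 1ℚ * g)) ≡ f * f + 1ℚ * (g * g)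
  e = solve-∀ ringℚ

p≤3^n*p : ∀ n {p} → 0ℚ ≤ p → p ≤ 3ℚ ^ n * p
p≤3^n*p n {p} 0≤p = ≤-respˡ (sym (*-identityˡ p)) (*-monoʳ-≤ 0≤p (1≤^ n (≤ᵇ⇒≤ _)))

-- The Bonami lemma.  Stating it for two forms makes the induction close without the
-- Cauchy–Schwarz inequality: 4 f₀f₁g₀g₁ ≤ 2 (f₀²g₁² + f₁²g₀²) pointwise.
bonami : ∀ {n} a b (v w : Subset n → ℚ) →
  avg (λ x → (form a v x * form a v x) * (form b w x * form b w x)) ≤ (3ℚ ^ a * normSq a v) * (3ℚ ^ b * normSq b w)
bonami zero b v w = ≤-respˡ
  (trans (avg-* (v ⊥ * v ⊥) (λ x → form b w x * form b w x)) (cong (v ⊥ * v ⊥ *_) (avg-form² b w)))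
  (*-mono-≤ (0≤* 0≤1 (0≤p*p (v ⊥))) (0≤normSq b w) (p≤3^n*p 0 (0≤p*p (v ⊥))) (p≤3^n*p b (0≤normSq b w)))
bonami (suc a) zero v w = ≤-respˡ
  (trans (avg-cong (λ x → *-comm (form (suc a) v x * form (suc a) v x) (w ⊥ * w ⊥)))
    (trans (avg-* (w ⊥ * w ⊥) (λ x → form (suc a) v x * form (suc a) v x))
      (trans (cong (w ⊥ * w ⊥ *_) (avg-form² (suc a) v)) (*-comm (w ⊥ * w ⊥) (normSq (suc a) v)))))
  (*-mono-≤ (0≤* (0≤^ (suc a) 0≤3) (0≤normSq (suc a) v)) (0≤p*p (w ⊥)) (p≤3^n*p (suc a) (0≤normSq (suc a) v)) (p≤3^n*p 0 (0≤p*p (w ⊥))))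
bonami {zero}  (suc a) (suc b) v w = ≤-reflexive (e (3ℚ ^ suc a) (3ℚ ^ suc b))
  where
  e : ∀ x y → 0ℚ ≡ (x * 0ℚ) * (y * 0ℚ)
  e = solve-∀ ringℚ
bonami {suc n} (suc a) (suc b) v w =
  ≤-respˡ (avg-suc (λ x → (form (suc a) v x * form (suc a) v x) * (form (suc b) w x * form (suc b) w x)))
    (≤-trans (avg-mono {g = λ x → ½ * (sq (f₀ x + 1ℚ * f₁ x) * sq (g₀ x + 1ℚ * g₁ x) + sq (f₀ x + - 1ℚ * f₁ x) * sq (g₀ x + - 1ℚ * g₁ x))}
                (λ x _ → pointwise (f₀ x) (f₁ x) (g₀ x) (g₁ x)))
      (≤-respˡ split (≤-trans (+-mono-≤ (+-mono-≤ IH₀₀ IH₁₁) (*-monoˡ-≤ 0≤3 (+-mono-≤ IH₀₁ IH₁₀))) final)))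
  where
  f₀ f₁ g₀ g₁ : Vector ℚ n → ℚ
  f₀ = form (suc a) (lo v)
  f₁ = form a (hi v)
  g₀ = form (suc b) (lo w)
  g₁ = form b (hi w)
  sq : ℚ → ℚ
  sq p = p * p
  F₀ F₁ G₀ G₁ A B : ℚ
  F₀ = normSq (suc a) (lo v)
  F₁ = normSq a (hi v)
  G₀ = normSq (suc b) (lo w)
  G₁ = normSq b (hi w)
  A  = 3ℚ ^ a
  B  = 3ℚ ^ b
  expand : ∀ a b c d →
    (a * a) * (c * c) + (b * b) * (d * d) + 3ℚ * ((a * a) * (d * d) + (b * b) * (c * c))
    ≡ ½ * (((a + 1ℚ * b) * (a + 1ℚ * b)) * ((c + 1ℚ * d) * (c + 1ℚ * d))
         + ((a + - 1ℚ * b) * (a + - 1ℚ * b)) * ((c + - 1ℚ * d) * (c + - 1ℚ * d)))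
      + 2ℚ * ((a * d - b * c) * (a * d - b * c))
  expand = solve-∀ ringℚ
  pointwise : ∀ a b c d → ½ * (sq (a + 1ℚ * b) * sq (c + 1ℚ * d) + sq (a + - 1ℚ * b) * sq (c + - 1ℚ * d))
    ≤ sq a * sq c + sq b * sq d + 3ℚ * (sq a * sq d + sq b * sq c)
  pointwise a b c d = q≡p+z⇒p≤q _ (expand a b c d) (0≤* 0≤2 (0≤p*p (a * d - b * c)))
  prod : (f g : Vector ℚ n → ℚ) → Vector ℚ n → ℚ
  prod f g x = sq (f x) * sq (g x)
  split : avg (λ x → prod f₀ g₀ x + prod f₁ g₁ x + 3ℚ * (prod f₀ g₁ x + prod f₁ g₀ x))
    ≡ avg (prod f₀ g₀) + avg (prod f₁ g₁) + 3ℚ * (avg (prod f₀ g₁) + avg (prod f₁ g₀))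
  split = trans (avg-+ (λ x → prod f₀ g₀ x + prod f₁ g₁ x) (λ x → 3ℚ * (prod f₀ g₁ x + prod f₁ g₀ x)))
    (cong₂ _+_ (avg-+ (prod f₀ g₀) (prod f₁ g₁))
      (trans (avg-* 3ℚ (λ x → prod f₀ g₁ x + prod f₁ g₀ x)) (cong (3ℚ *_) (avg-+ (prod f₀ g₁) (prod f₁ g₀)))))
  IH₀₀ = bonami (suc a) (suc b) (lo v) (lo w)
  IH₁₁ = bonami a b (hi v) (hi w)
  IH₀₁ = bonami (suc a) b (lo v) (hi w)
  IH₁₀ = bonami a (suc b) (hi v) (lo w)
  -- All terms on the right match the induction hypotheses exactly, except that F₁G₁ is allowed the
  -- factor 3 · 3 = 9 and needs only 1, which leaves the surplus 8.
  collect : ∀ A B F₀ F₁ G₀ G₁ →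
    ((3ℚ * A) * (F₀ + 1ℚ * F₁)) * ((3ℚ * B) * (G₀ + 1ℚ * G₁))
    ≡ ((3ℚ * A) * F₀) * ((3ℚ * B) * G₀) + (A * F₁) * (B * G₁)
      + 3ℚ * (((3ℚ * A) * F₀) * (B * G₁) + (A * F₁) * ((3ℚ * B) * G₀))
      + 8ℚ * ((A * F₁) * (B * G₁))
  collect = solve-∀ ringℚ
  final : ((3ℚ * A) * F₀) * ((3ℚ * B) * G₀) + (A * F₁) * (B * G₁)
      + 3ℚ * (((3ℚ * A) * F₀) * (B * G₁) + (A * F₁) * ((3ℚ * B) * G₀))
    ≤ (3ℚ ^ suc a * normSq (suc a) v) * (3ℚ ^ suc b * normSq (suc b) w)
  final = q≡p+z⇒p≤q _ (collect A B F₀ F₁ G₀ G₁)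
    (0≤* 0≤8 (0≤* (0≤* (0≤^ a 0≤3) (0≤normSq a (hi v))) (0≤* (0≤^ b 0≤3) (0≤normSq b (hi w)))))

-- Binomial coefficients and edge counts

toℚᵘ-/ : ∀ i n → toℚᵘ (i / suc n) ℚᵘ.≃ mkℚᵘ i n
toℚᵘ-/ i n = toℚᵘ-fromℚᵘ (mkℚᵘ i n)

fromℕ-+ : ∀ a b → fromℕ (a ℕ.+ b) ≡ fromℕ a + fromℕ b
fromℕ-+ a b = toℚᵘ-injective (ℚᵘ.≃-trans (toℚᵘ-/ (ℤ.+ (a ℕ.+ b)) 0) (ℚᵘ.≃-trans (*≡* (cong (ℤ._* ℤ.1ℤ) (trans (ℤ.pos-+ a b) (e (ℤ.+ a) (ℤ.+ b)))))
  (ℚᵘ.≃-sym (ℚᵘ.≃-trans (toℚᵘ-homo-+ (fromℕ a) (fromℕ b)) (ℚᵘ.+-cong (toℚᵘ-/ (ℤ.+ a) 0) (toℚᵘ-/ (ℤ.+ b) 0))))))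
  where
  e : ∀ x y → x ℤ.+ y ≡ x ℤ.* ℤ.1ℤ ℤ.+ y ℤ.* ℤ.1ℤ
  e = ℤ.solve-∀

fromℕ-* : ∀ a b → fromℕ (a ℕ.* b) ≡ fromℕ a * fromℕ b
fromℕ-* zero    b = sym (*-zeroˡ (fromℕ b))
fromℕ-* (suc a) b = trans (fromℕ-+ b (a ℕ.* b)) (trans (cong (fromℕ b +_) (fromℕ-* a b))
  (trans (e (fromℕ a) (fromℕ b)) (cong (_* fromℕ b) (sym (fromℕ-+ 1 a)))))
  where
  e : ∀ x y → y + x * y ≡ (1ℚ + x) * y
  e = solve-∀ ringℚ

0≤fromℕ : ∀ a → 0ℚ ≤ fromℕ a
0≤fromℕ zero    = ≤-refl
0≤fromℕ (suc a) = ≤-respʳ (sym (fromℕ-+ 1 a)) (0≤+ 0≤1 (0≤fromℕ a))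

0<fromℕ : ∀ a → 0ℚ < fromℕ (suc a)
0<fromℕ a = <-≤-trans (positive⁻¹ 1ℚ) (q≡p+z⇒p≤q (fromℕ a) (fromℕ-+ 1 a) (0≤fromℕ a))

ratio-* : ∀ a b → ratio a (suc b) * fromℕ (suc b) ≡ fromℕ a
ratio-* a b = toℚᵘ-injective (ℚᵘ.≃-trans (toℚᵘ-homo-* (ratio a (suc b)) (fromℕ (suc b)))
  (ℚᵘ.≃-trans (ℚᵘ.*-cong (toℚᵘ-/ (ℤ.+ a) b) (toℚᵘ-/ (ℤ.+ suc b) 0))
    (ℚᵘ.≃-trans (*≡* (e (ℤ.+ a) (ℤ.+ suc b))) (ℚᵘ.≃-sym (toℚᵘ-/ (ℤ.+ a) 0)))))
  where
  e : ∀ x y → x ℤ.* y ℤ.* ℤ.1ℤ ≡ x ℤ.* (y ℤ.* ℤ.1ℤ)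
  e = ℤ.solve-∀

0≤ratio : ∀ a b → 0ℚ ≤ ratio a b
0≤ratio a zero    = ≤-refl
0≤ratio a (suc b) = nonNegative⁻¹ _ {{normalize-nonNeg a (suc b)}}

-- Both sides count pairs of a vertex and an (r+1)-set containing it. This converts the average
-- degree into the density times a binomial coefficient.
binomial-absorption : ∀ m r → suc m ℕ.* (m C r) ≡ suc r ℕ.* (suc m C suc r)
binomial-absorption zero    zero    = refl
binomial-absorption zero    (suc r) = sym (ℕ.*-zeroʳ (2 ℕ.+ r))
binomial-absorption (suc m) zero    = trans (ℕ.*-identityʳ (2 ℕ.+ m)) (sym (trans (ℕ.*-identityˡ _) (nC1≡n (2 ℕ.+ m))))
binomial-absorption (suc m) (suc r) = begin
  suc (suc m) ℕ.* X                                   ≡⟨ cong (X ℕ.+_) (cong (suc m ℕ.*_) (sym (nCk+nC[k+1]≡[n+1]C[k+1] m r))) ⟩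
  X ℕ.+ suc m ℕ.* (m C r ℕ.+ m C suc r)               ≡⟨ cong (X ℕ.+_) (ℕ.*-distribˡ-+ (suc m) (m C r) (m C suc r)) ⟩
  X ℕ.+ (suc m ℕ.* (m C r) ℕ.+ suc m ℕ.* (m C suc r)) ≡⟨ cong (X ℕ.+_) (cong₂ ℕ._+_ (binomial-absorption m r) (binomial-absorption m (suc r))) ⟩
  X ℕ.+ (suc r ℕ.* X ℕ.+ suc (suc r) ℕ.* Y)           ≡⟨ e X Y r ⟩
  suc (suc r) ℕ.* (X ℕ.+ Y)                           ≡⟨ cong (suc (suc r) ℕ.*_) (nCk+nC[k+1]≡[n+1]C[k+1] (suc m) (suc r)) ⟩
  suc (suc r) ℕ.* (suc (suc m) C suc (suc r))         ∎
  where
  open ≡-Reasoning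
  X Y : ℕ
  X = suc m C suc r
  Y = suc m C suc (suc r)
  e : ∀ X Y r → X ℕ.+ (suc r ℕ.* X ℕ.+ suc (suc r) ℕ.* Y) ≡ suc (suc r) ℕ.* (X ℕ.+ Y)
  e = ℕ.solve-∀

pascal : ∀ m r → fromℕ (m C suc r) + 1ℚ * fromℕ (m C r) ≡ fromℕ (suc m C suc r)
pascal m r = trans (e (fromℕ (m C suc r)) (fromℕ (m C r)))
  (trans (sym (fromℕ-+ (m C r) (m C suc r))) (cong fromℕ (nCk+nC[k+1]≡[n+1]C[k+1] m r)))
  where
  e : ∀ x y → x + 1ℚ * y ≡ y + x
  e = solve-∀ ringℚ

form-1-χ : ∀ {n} r (U : Subset n) → form r (const 1ℚ) (χ U) ≡ fromℕ (Sub.∣ U ∣ C r)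
form-1-χ zero    U  = refl
form-1-χ (suc r) [] = refl
form-1-χ (suc r) (outside ∷ U) = trans (e _ (form r (const 1ℚ) (χ U))) (form-1-χ (suc r) U)
  where
  e : ∀ p q → p + 0ℚ * q ≡ p
  e = solve-∀ ringℚ
form-1-χ (suc r) (inside ∷ U) = trans (cong₂ (λ p q → p + 1ℚ * q) (form-1-χ (suc r) U) (form-1-χ r U)) (pascal Sub.∣ U ∣ r)

form-1-1 : ∀ n r → form {n} r (const 1ℚ) (const 1ℚ) ≡ fromℕ (n C r)
form-1-1 n r = trans (form-congˣ r (const 1ℚ) (λ i → cong (if_then 1ℚ else 0ℚ) (sym (lookup-replicate i inside))))
  (trans (form-1-χ r ⊤) (cong (λ m → fromℕ (m C r)) (∣⊤∣≡n n)))

form-∂1-1 : ∀ {m} r (i : Fin (suc m)) → form r (∂ i (const 1ℚ)) (const 1ℚ) ≡ fromℕ (m C r)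
form-∂1-1 {m} r zero = trans (form-∂zero r (const 1ℚ) (const 1ℚ)) (form-1-1 m r)
form-∂1-1 {suc m} zero    (suc i) = form-∂1-1 zero i
form-∂1-1 {suc m} (suc r) (suc i) = trans (cong₂ (λ p q → p + 1ℚ * q) (form-∂1-1 (suc r) i) (form-∂1-1 r i)) (pascal m r)

∂-linear : ∀ {n} a b (v w : Subset n → ℚ) i e → ∂ i (λ e → a * v e + b * w e) e ≡ a * ∂ i v e + b * ∂ i w e
∂-linear a b v w zero    (outside ∷ e) = refl
∂-linear a b v w zero    (inside ∷ e)  = eq a b
  where
  eq : ∀ a b → 0ℚ ≡ a * 0ℚ + b * 0ℚ
  eq = solve-∀ ringℚ
∂-linear a b v w (suc i) (x ∷ e) = ∂-linear a b (v ∘ (x ∷_)) (w ∘ (x ∷_)) i e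

form-∂-linear : ∀ {n} r a b (v w : Subset n → ℚ) i x →
  form r (∂ i (λ e → a * v e + b * w e)) x ≡ a * form r (∂ i v) x + b * form r (∂ i w) x
form-∂-linear r a b v w i x = trans (form-cong r x (∂-linear a b v w i))
  (trans (form-+ r (λ e → a * ∂ i v e) (λ e → b * ∂ i w e) x) (cong₂ _+_ (form-* r a (∂ i v) x) (form-* r b (∂ i w) x)))

∂-cong : ∀ {n} {v w : Subset n → ℚ} i → (∀ e → v e ≡ w e) → ∀ e → ∂ i v e ≡ ∂ i w e
∂-cong zero    h (outside ∷ e) = h (inside ∷ e)
∂-cong zero    h (inside ∷ e)  = refl
∂-cong (suc i) h (x ∷ e)       = ∂-cong i (h ∘ (x ∷_)) e

∂-² : ∀ {n} (w : Subset n → ℚ) i e → ∂ i w e * ∂ i w e ≡ ∂ i (λ e → w e * w e) e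
∂-² w zero    (outside ∷ e) = refl
∂-² w zero    (inside ∷ e)  = refl
∂-² w (suc i) (x ∷ e)       = ∂-² (w ∘ (x ∷_)) i e

-- Edge sets as weight functions

-- The Kronecker delta, by recursion on both sets, so that `lo` and `hi` of `δ d` reduce to a
-- smaller delta or to 0.
δ : ∀ {n} → Subset n → Subset n → ℚ
δ []            []            = 1ℚ
δ (inside ∷ d)  (inside ∷ e)  = δ d e
δ (inside ∷ d)  (outside ∷ e) = 0ℚ
δ (outside ∷ d) (inside ∷ e)  = 0ℚ
δ (outside ∷ d) (outside ∷ e) = δ d e

δ-dichotomy : ∀ {n} (d e : Subset n) → (d ≡ e × δ d e ≡ 1ℚ) ⊎ δ d e ≡ 0ℚ
δ-dichotomy []            []            = inj₁ (refl , refl)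
δ-dichotomy (inside ∷ d)  (outside ∷ e) = inj₂ refl
δ-dichotomy (outside ∷ d) (inside ∷ e)  = inj₂ refl
δ-dichotomy (inside ∷ d)  (inside ∷ e) with δ-dichotomy d e
... | inj₁ (refl , h) = inj₁ (refl , h)
... | inj₂ h          = inj₂ h
δ-dichotomy (outside ∷ d) (outside ∷ e) with δ-dichotomy d e
... | inj₁ (refl , h) = inj₁ (refl , h)
... | inj₂ h          = inj₂ h

-- The form of a single edge is the monomial Π_{i ∈ d} x_i; the size condition places d in the
-- degree that `form r` sees.
form-δ : ∀ {n} r (d U : Subset n) → Sub.∣ d ∣ ≡ r → form r (δ d) (χ U) ≡ (if does (d ⊆? U) then 1ℚ else 0ℚ)
form-δ zero    []            []            refl = refl
form-δ zero    (outside ∷ d) (_ ∷ U)       eq   = form-δ zero d U eq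
form-δ (suc r) (outside ∷ d) (x ∷ U)       eq   = trans
  (cong (λ q → form (suc r) (δ d) (χ U) + χ (x ∷ U) zero * q) (form-0 r (χ U)))
  (trans (e (form (suc r) (δ d) (χ U)) (χ (x ∷ U) zero)) (form-δ (suc r) d U eq))
  where
  e : ∀ a t → a + t * 0ℚ ≡ a
  e = solve-∀ ringℚ
form-δ (suc r) (inside ∷ d)  (outside ∷ U) eq   = trans (cong (_+ 0ℚ * form r (δ d) (χ U)) (form-0 (suc r) (χ U))) (e (form r (δ d) (χ U)))
  where
  e : ∀ q → 0ℚ + 0ℚ * q ≡ 0ℚ
  e = solve-∀ ringℚ
form-δ (suc r) (inside ∷ d)  (inside ∷ U)  eq   = trans (cong₂ (λ p q → p + 1ℚ * q) (form-0 (suc r) (χ U)) (form-δ r d U (ℕ.suc-injective eq))) (e _)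
  where
  e : ∀ q → 0ℚ + 1ℚ * q ≡ q
  e = solve-∀ ringℚ

indicator : ∀ {n} → List (Subset n) → Subset n → ℚ
indicator []       e = 0ℚ
indicator (d ∷ ds) e = δ d e + indicator ds e

indicator-∉ : ∀ {n} {e : Subset n} {ds} → All (e ≢_) ds → indicator ds e ≡ 0ℚ
indicator-∉ [] = refl
indicator-∉ {e = e} {d ∷ ds} (e≢d ∷ h) with δ-dichotomy d e
... | inj₁ (refl , _) = contradiction refl e≢d
... | inj₂ δ≡0        = cong₂ _+_ δ≡0 (indicator-∉ h)

-- Without duplicates the multiplicity count takes only the values 0 and 1. This is what makes the
-- squared weights an affine function of the indicator.
indicator-idem : ∀ {n} {ds : List (Subset n)} → Unique ds → ∀ e → indicator ds e * indicator ds e ≡ indicator ds e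
indicator-idem []      e = refl
indicator-idem {ds = d ∷ ds} (d∉ds ∷ u) e with δ-dichotomy d e
... | inj₁ (refl , δ≡1) = trans (cong (λ z → z * z) one) (sym one)
  where
  one : δ d d + indicator ds d ≡ 1ℚ
  one = cong₂ _+_ δ≡1 (indicator-∉ d∉ds)
... | inj₂ δ≡0 = trans (cong (λ z → z * z) same) (trans (indicator-idem u e) (sym same))
  where
  same : δ d e + indicator ds e ≡ indicator ds e
  same = trans (cong (_+ indicator ds e) δ≡0) (+-identityˡ _)

form-indicator : ∀ {n} r {ds : List (Subset n)} → All (λ e → Sub.∣ e ∣ ≡ r) ds → ∀ U →
  form r (indicator ds) (χ U) ≡ fromℕ (length (filter (_⊆? U) ds))
form-indicator r [] U = form-0 r (χ U)
form-indicator r {d ∷ ds} (∣d∣≡r ∷ h) U = trans (form-+ r (δ d) (indicator ds) (χ U))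
  (trans (cong₂ _+_ (form-δ r d U ∣d∣≡r) (form-indicator r h U)) count)
  where
  count : (if does (d ⊆? U) then 1ℚ else 0ℚ) + fromℕ (length (filter (_⊆? U) ds)) ≡ fromℕ (length (filter (_⊆? U) (d ∷ ds)))
  count with does (d ⊆? U)
  ... | true  = sym (fromℕ-+ 1 (length (filter (_⊆? U) ds)))
  ... | false = +-identityˡ _

-- The lower bound

sum-mono : ∀ {n} {f g : Vector ℚ n} → (∀ i → f i ≤ g i) → sum f ≤ sum g
sum-mono {zero}  h = ≤-refl
sum-mono {suc n} h = +-mono-≤ (h zero) (sum-mono (h ∘ suc))

sum-const : ∀ n c → sum {n} (const c) ≡ fromℕ n * c
sum-const zero    c = sym (*-zeroˡ c)
sum-const (suc n) c = trans (cong (c +_) (sum-const n c)) (trans (e (fromℕ n) c) (cong (_* c) (sym (fromℕ-+ 1 n))))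
  where
  e : ∀ x c → c + x * c ≡ (1ℚ + x) * c
  e = solve-∀ ringℚ

-- 2a³u + u⁴ − 3a²u² = u (u − a)² (u + 2a)
3a²t²≤2a³∣t∣+t⁴ : ∀ {a} t → 0ℚ ≤ a → 3ℚ * (a * a) * (t * t) ≤ 2ℚ * (a * a * a) * ∣ t ∣ + (t * t) * (t * t)
3a²t²≤2a³∣t∣+t⁴ {a} t 0≤a = ≤-respˡ (cong (3ℚ * (a * a) *_) (sym ∣t∣²))
  (≤-respʳ (cong (λ z → 2ℚ * (a * a * a) * ∣ t ∣ + z * z) ∣t∣²)
    (q≡p+z⇒p≤q _ (e a ∣ t ∣) (0≤* (0≤* (0≤∣p∣ t) (0≤p*p (∣ t ∣ - a))) (0≤+ (0≤∣p∣ t) (0≤* 0≤2 0≤a)))))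
  where
  ∣t∣² : ∣ t ∣ * ∣ t ∣ ≡ t * t
  ∣t∣² = ∣p∣*∣p∣≡p*p t
  e : ∀ a u → 2ℚ * (a * a * a) * u + (u * u) * (u * u) ≡ 3ℚ * (a * a) * (u * u) + u * ((u - a) * (u - a)) * (u + 2ℚ * a)
  e = solve-∀ ringℚ

-- Averages the preceding pointwise inequality over t = `form r w x`. Parseval evaluates the second
-- moment, and `bonami` with both forms equal bounds the fourth.
first-moment : ∀ {n} r (w : Subset n → ℚ) {a} → 0ℚ ≤ a →
  3ℚ * (a * a) * normSq r w ≤ 2ℚ * (a * a * a) * avg (λ x → ∣ form r w x ∣) + (3ℚ ^ r * normSq r w) * (3ℚ ^ r * normSq r w)
first-moment r w {a} 0≤a = ≤-trans (≤-respˡ lhs (≤-respʳ rhs (avg-mono (λ x _ → 3a²t²≤2a³∣t∣+t⁴ (f x) 0≤a))))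
  (+-monoʳ-≤ (2ℚ * (a * a * a) * avg (λ x → ∣ f x ∣)) (bonami r r w w))
  where
  f = form r w
  lhs : 3ℚ * (a * a) * normSq r w ≡ avg (λ x → 3ℚ * (a * a) * (f x * f x))
  lhs = sym (trans (avg-* (3ℚ * (a * a)) (λ x → f x * f x)) (cong (3ℚ * (a * a) *_) (avg-form² r w)))
  rhs : avg (λ x → 2ℚ * (a * a * a) * ∣ f x ∣ + (f x * f x) * (f x * f x))
    ≡ 2ℚ * (a * a * a) * avg (λ x → ∣ f x ∣) + avg (λ x → (f x * f x) * (f x * f x))
  rhs = trans (avg-+ (λ x → 2ℚ * (a * a * a) * ∣ f x ∣) (λ x → (f x * f x) * (f x * f x)))
    (cong (_+ avg (λ x → (f x * f x) * (f x * f x))) (avg-* (2ℚ * (a * a * a)) (λ x → ∣ f x ∣)))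

-- Here k plays the part of √d: a second moment of order k² forces a first absolute moment of order
-- k, since the fourth moment is under control.
khinchine : ∀ {n} r (w : Subset n → ℚ) {k} → 1ℚ ≤ k → k * k ≤ 2ℚ * normSq r w → normSq r w ≤ 8ℚ * (k * k) →
  k ≤ 8ℚ * (3ℚ ^ r * avg (λ x → ∣ form r w x ∣))
khinchine r w {k} 1≤k lower upper = *-cancelˡ-≤-pos c {{positive 0<c}} (≤-trans step₁ step₂)
  where
  T Q A a c : ℚ
  T = 3ℚ ^ r
  Q = normSq r w
  A = avg (λ x → ∣ form r w x ∣)
  -- With this a, `first-moment` reads 12 T²k²Q ≤ 16 T³k³A + T²Q². By `upper` the last term is at
  -- most 8 T²k²Q, which leaves 4 T²k²Q ≤ 16 T³k³A, and by `lower` the left side is at least 2 T²k⁴.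
  -- The common factor `c` then cancels.
  a = 2ℚ * (T * k)
  c = 2ℚ * ((T * T) * (k * (k * k)))
  0≤k : 0ℚ ≤ k
  0≤k = ≤-trans 0≤1 1≤k
  1≤T : 1ℚ ≤ T
  1≤T = 1≤^ r (≤ᵇ⇒≤ _)
  0≤T : 0ℚ ≤ T
  0≤T = ≤-trans 0≤1 1≤T
  0<c : 0ℚ < c
  0<c = <-≤-trans (positive⁻¹ 1ℚ) (1≤* {2ℚ} (≤ᵇ⇒≤ _) (1≤* (1≤* 1≤T 1≤T) (1≤* 1≤k (1≤* 1≤k 1≤k))))
  e₁ : ∀ T k Q → 4ℚ * ((T * T) * ((k * k) * Q)) ≡ 2ℚ * ((T * T) * (k * (k * k))) * k + 2ℚ * ((T * T) * (k * k)) * (2ℚ * Q - k * k)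
  e₁ = solve-∀ ringℚ
  step₁ : c * k ≤ 4ℚ * ((T * T) * ((k * k) * Q))
  step₁ = q≡p+z⇒p≤q _ (e₁ T k Q) (0≤* (0≤* 0≤2 (0≤* (0≤p*p T) (0≤p*p k))) (0≤q-p lower))
  e₂ : ∀ T k Q A → 2ℚ * ((T * T) * (k * (k * k))) * (8ℚ * (T * A))
    ≡ 4ℚ * ((T * T) * ((k * k) * Q))
    + ((2ℚ * ((2ℚ * (T * k)) * (2ℚ * (T * k)) * (2ℚ * (T * k))) * A + (T * Q) * (T * Q) - 3ℚ * ((2ℚ * (T * k)) * (2ℚ * (T * k))) * Q)
      + (T * T) * (Q * (8ℚ * (k * k) - Q)))
  e₂ = solve-∀ ringℚ
  step₂ : 4ℚ * ((T * T) * ((k * k) * Q)) ≤ c * (8ℚ * (T * A))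
  step₂ = q≡p+z⇒p≤q _ (e₂ T k Q A) (0≤+ (0≤q-p (first-moment r w {a} (0≤* 0≤2 (0≤* 0≤T 0≤k))))
    (0≤* (0≤p*p T) (0≤* (0≤normSq r w) (0≤q-p upper))))

fromℕ≤4^ : ∀ m → fromℕ m ≤ 4ℚ ^ m
fromℕ≤4^ zero    = 0≤1
fromℕ≤4^ (suc m) = ≤-respˡ (fromℕ-+ 1 m) (≤-trans (+-mono-≤ (1≤^ m 1≤4) (fromℕ≤4^ m))
  (q≡p+z⇒p≤q _ (e (4ℚ ^ m)) (0≤* 0≤2 (≤-trans 0≤1 (1≤^ m 1≤4)))))
  where
  1≤4 : 1ℚ ≤ 4ℚ
  1≤4 = ≤ᵇ⇒≤ _
  e : ∀ x → 4ℚ * x ≡ (x + x) + 2ℚ * x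
  e = solve-∀ ringℚ

-- A rational stand-in for √d, correct up to a factor 2. The candidate k is doubled until 4k²
-- reaches d, and N bounds the number of doublings.
approximate-root : ∀ N {d k} → 1ℚ ≤ k → k * k ≤ d → d ≤ 4ℚ ^ N * (4ℚ * (k * k)) →
  ∃[ l ] (1ℚ ≤ l × l * l ≤ d × d ≤ 4ℚ * (l * l))
approximate-root zero {d} {k} 1≤k kk≤d d≤ = k , 1≤k , kk≤d , ≤-respʳ (*-identityˡ _) d≤
approximate-root (suc N) {d} {k} 1≤k kk≤d d≤ with d ≤? 4ℚ * (k * k)
... | yes h = k , 1≤k , kk≤d , h
... | no ¬h = approximate-root N {d} {2ℚ * k} (*-mono-≤ {1ℚ} 0≤2 0≤1 (≤ᵇ⇒≤ _) 1≤k)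
  (≤-respˡ (e₁ k) (<⇒≤ (≰⇒> ¬h))) (≤-respʳ (e₂ k (4ℚ ^ N)) d≤)
  where
  e₁ : ∀ k → (2ℚ * k) * (2ℚ * k) ≡ 4ℚ * (k * k)
  e₁ = solve-∀ ringℚ
  e₂ : ∀ k x → (4ℚ * x) * (4ℚ * (k * k)) ≡ x * (4ℚ * ((2ℚ * k) * (2ℚ * k)))
  e₂ = solve-∀ ringℚ

-- Either the degree of i is within a factor 2 of d, and the second moment of the i-th
-- derivative is of order d, or the degree deviation itself is at least d / 2.
vertex-bound : ∀ {m} r (E : Subset (suc m) → ℚ) → (∀ e → E e * E e ≡ E e) →
  ∀ {p d k} → 0ℚ ≤ p → p ≤ ½ → d ≡ p * fromℕ (m C r) → 1ℚ ≤ k → k * k ≤ d → d ≤ 4ℚ * (k * k) →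
  let w = λ e → 1ℚ * E e + - p * 1ℚ in
  ∀ i → k ≤ 8ℚ * (3ℚ ^ r * (avg (λ x → ∣ form r (∂ i w) x ∣) + ∣ form r (∂ i w) (const 1ℚ) ∣))
vertex-bound {m} r E idem {p} {d} {k} 0≤p p≤½ d≡pC 1≤k kk≤d d≤4kk i = go (∣ D ∣ ≤? ½ * d)
  where
  w : Subset (suc m) → ℚ
  w e = 1ℚ * E e + - p * 1ℚ
  D g Q A T : ℚ
  D = form r (∂ i w) (const 1ℚ)
  g = form r (∂ i E) (const 1ℚ)
  Q = normSq r (∂ i w)
  A = avg (λ x → ∣ form r (∂ i w) x ∣)
  T = 3ℚ ^ r
  C₁ : ℚ
  C₁ = fromℕ (m C r)
  e-D : ∀ g p C → 1ℚ * g + - p * C ≡ g - p * C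
  e-D = solve-∀ ringℚ
  D≡g-d : D ≡ g - d
  D≡g-d = trans (form-∂-linear r 1ℚ (- p) E (const 1ℚ) i (const 1ℚ))
    (trans (cong (λ z → 1ℚ * g + - p * z) (form-∂1-1 r i)) (trans (e-D g p C₁) (cong (λ z → g - z) (sym d≡pC))))
  e-w² : ∀ x p → (1ℚ * x + - p * 1ℚ) * (1ℚ * x + - p * 1ℚ) ≡ x * x + - (2ℚ * p) * x + p * p * 1ℚ
  e-w² = solve-∀ ringℚ
  e-w²′ : ∀ x p → x + - (2ℚ * p) * x + p * p * 1ℚ ≡ (1ℚ - 2ℚ * p) * x + p * p * 1ℚ
  e-w²′ = solve-∀ ringℚ
  w² : ∀ e → w e * w e ≡ (1ℚ - 2ℚ * p) * E e + p * p * 1ℚ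
  w² e = trans (e-w² (E e) p) (trans (cong (λ z → z + - (2ℚ * p) * E e + p * p * 1ℚ) (idem e)) (e-w²′ (E e) p))
  Q≡ : Q ≡ (1ℚ - 2ℚ * p) * g + p * d
  Q≡ = trans (form-cong r (const 1ℚ) (λ e → trans (∂-² w i e) (∂-cong i w² e)))
    (trans (form-∂-linear r (1ℚ - 2ℚ * p) (p * p) E (const 1ℚ) i (const 1ℚ))
      (cong ((1ℚ - 2ℚ * p) * g +_) (trans (cong (p * p *_) (form-∂1-1 r i)) (trans (*-assoc p p C₁) (cong (p *_) (sym d≡pC))))))
  0≤k : 0ℚ ≤ k
  0≤k = ≤-trans 0≤1 1≤k
  0≤d : 0ℚ ≤ d
  0≤d = ≤-trans (0≤p*p k) kk≤d
  0≤A : 0ℚ ≤ A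
  0≤A = ≤-respˡ (sym (avg-const {suc m} 0ℚ)) (avg-mono (λ x _ → 0≤∣p∣ (form r (∂ i w) x)))
  1≤T : 1ℚ ≤ T
  1≤T = 1≤^ r (≤ᵇ⇒≤ _)
  0≤1-2p : 0ℚ ≤ 1ℚ - 2ℚ * p
  0≤1-2p = 0≤q-p (*-monoˡ-≤ 0≤2 p≤½)
  go : Dec (∣ D ∣ ≤ ½ * d) → k ≤ 8ℚ * (T * (A + ∣ D ∣))
  go (yes ∣D∣≤) = ≤-trans (khinchine r (∂ i w) 1≤k lower upper)
    (*-monoˡ-≤ 0≤8 (*-monoˡ-≤ (≤-trans 0≤1 1≤T) (q≡p+z⇒p≤q ∣ D ∣ refl (0≤∣p∣ D))))
    where
    g-d≤ : 0ℚ ≤ ½ * d - (g - d)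
    g-d≤ = 0≤q-p (≤-respˡ (sym D≡g-d) (≤-trans (p≤∣p∣ D) ∣D∣≤))
    d-g≤ : 0ℚ ≤ ½ * d - - (g - d)
    d-g≤ = 0≤q-p (≤-respˡ (cong -_ (sym D≡g-d)) (≤-trans (-p≤∣p∣ D) ∣D∣≤))
    e₁ : ∀ p g d → 2ℚ * ((1ℚ - 2ℚ * p) * g + p * d) ≡ d + 2ℚ * ((1ℚ - 2ℚ * p) * (½ * d - - (g - d)))
    e₁ = solve-∀ ringℚ
    e₂ : ∀ p g d → 2ℚ * d ≡ ((1ℚ - 2ℚ * p) * g + p * d) + ((1ℚ - 2ℚ * p) * (½ * d - (g - d)) + (½ * d + 2ℚ * (p * d)))
    e₂ = solve-∀ ringℚ
    e₃ : ∀ x → 2ℚ * (4ℚ * x) ≡ 8ℚ * x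
    e₃ = solve-∀ ringℚ
    -- From g ≥ d/2 and 1 - 2p ≥ 0: 2Q ≥ (1 - 2p) d + 2pd = d.
    lower : k * k ≤ 2ℚ * Q
    lower = ≤-trans kk≤d (≤-respʳ (cong (2ℚ *_) (sym Q≡)) (q≡p+z⇒p≤q _ (e₁ p g d) (0≤* 0≤2 (0≤* 0≤1-2p d-g≤))))
    -- From g ≤ 3d/2: Q ≤ 3d/2 - 2pd ≤ 2d ≤ 8k².
    upper : Q ≤ 8ℚ * (k * k)
    upper = ≤-respˡ Q≡ (≤-trans
      (q≡p+z⇒p≤q _ (e₂ p g d) (0≤+ (0≤* 0≤1-2p g-d≤) (0≤+ (0≤* 0≤½ 0≤d) (0≤* 0≤2 (0≤* 0≤p 0≤d)))))
      (≤-respʳ (e₃ (k * k)) (*-monoˡ-≤ 0≤2 d≤4kk)))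
  -- Here k ≥ 1 is essential: k ≤ k² ≤ d ≤ 2 ∣D∣, so a deviation of order d also dominates k.
  go (no ∣D∣≰) = ≤-trans (≤-respˡ (sym (*-identityˡ k)) (*-monoʳ-≤ 0≤k 1≤k)) (≤-trans kk≤d
    (≤-trans d≤2∣D∣ (q≡p+z⇒p≤q _ (e₂ T A ∣ D ∣)
      (0≤+ (0≤* 0≤8 (0≤* (0≤q-p 1≤T) (0≤+ 0≤A (0≤∣p∣ D)))) (0≤+ (0≤* 0≤8 0≤A) (0≤* {6ℚ} (≤ᵇ⇒≤ _) (0≤∣p∣ D)))))))
    where
    6ℚ : ℚ
    6ℚ = ℤ.+ 6 / 1
    e₁ : ∀ d → 2ℚ * (½ * d) ≡ d
    e₁ = solve-∀ ringℚ
    e₂ : ∀ T A D → 8ℚ * (T * (A + D)) ≡ 2ℚ * D + (8ℚ * ((T - 1ℚ) * (A + D)) + (8ℚ * A + 6ℚ * D))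
    e₂ = solve-∀ ringℚ
    d≤2∣D∣ : d ≤ 2ℚ * ∣ D ∣
    d≤2∣D∣ = ≤-respˡ (sym (e₁ d)) (*-monoˡ-≤ 0≤2 (<⇒≤ (≰⇒> ∣D∣≰)))

-- Summing over the vertices gives two gradient sums. The gradient bound holds at every sign vector,
-- hence on average after exchanging sum and average; the other sum is its instance at (1,...,1).
vertex-sum : ∀ {m} r (w : Subset (suc m) → ℚ) {M k} → (∀ U → ∣ form (suc r) w (χ U) ∣ ≤ M) →
  (∀ i → k ≤ 8ℚ * (3ℚ ^ r * (avg (λ x → ∣ form r (∂ i w) x ∣) + ∣ form r (∂ i w) (const 1ℚ) ∣))) →
  fromℕ (suc m) * k ≤ 8ℚ * (3ℚ ^ r * (gradConst r * M + gradConst r * M))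
vertex-sum {m} r w {M} {k} h hk = ≤-respˡ (sym (sum-const (suc m) k)) (≤-trans (sum-mono hk) (≤-respˡ factor
  (*-monoˡ-≤ 0≤8 (*-monoˡ-≤ (0≤^ r 0≤3) (+-mono-≤ averaged (sum-∣∂∣≤ r w h (const 1ℚ) (λ _ → ≤-refl)))))))
  where
  A D : Vector ℚ (suc m)
  A i = avg (λ x → ∣ form r (∂ i w) x ∣)
  D i = ∣ form r (∂ i w) (const 1ℚ) ∣
  factor : sum (λ i → 8ℚ * (3ℚ ^ r * (A i + D i))) ≡ 8ℚ * (3ℚ ^ r * (sum A + sum D))
  factor = trans (sym (*-distribˡ-sum 8ℚ (λ i → 3ℚ ^ r * (A i + D i))))
    (cong (8ℚ *_) (trans (sym (*-distribˡ-sum (3ℚ ^ r) (λ i → A i + D i))) (cong (3ℚ ^ r *_) (∑-distrib-+ A D))))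
  averaged : sum A ≤ gradConst r * M
  averaged = ≤-respˡ (sym (avg-sum (λ i x → ∣ form r (∂ i w) x ∣)))
    (≤-respʳ (avg-const {suc m} (gradConst r * M)) (avg-mono (λ x ∣x∣≤1 → sum-∣∂∣≤ r w h x ∣x∣≤1)))

-- From forms back to hypergraphs

∣discOf∣≤disc : ∀ {r n} (H : Hypergraph r n) U → ∣ discOf H U ∣ ≤ disc H
∣discOf∣≤disc H U = All.lookup (xs≤max 0ℚ _) (∈-map⁺ (λ U → ∣ discOf H U ∣) (∈-allSubsets U))

form-discOf : ∀ {r n} (H : Hypergraph r n) U →
  form r (λ e → 1ℚ * indicator (edges H) e + - density H * 1ℚ) (χ U) ≡ discOf H U
form-discOf {r} H U = trans (form-+ r (λ e → 1ℚ * indicator (edges H) e) (const (- density H * 1ℚ)) (χ U))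
  (trans (cong₂ _+_ (trans (form-* r 1ℚ (indicator (edges H)) (χ U)) (cong (1ℚ *_) (form-indicator r (uniform H) U)))
                    (trans (form-* r (- density H) (const 1ℚ) (χ U)) (cong (- density H *_) (form-1-χ r U))))
    (e (fromℕ (edgesWithin H U)) (density H) (fromℕ (Sub.∣ U ∣ C r))))
  where
  e : ∀ a p b → 1ℚ * a + - p * b ≡ a - p * b
  e = solve-∀ ringℚ

-- By absorption. The nonvanishing condition excludes the junk value of `ratio` in the density.
averageDegree≡density*C : ∀ {r m} (H : Hypergraph (suc r) (suc m)) → suc m C suc r ≢ 0 →
  averageDegree H ≡ density H * fromℕ (m C r)
averageDegree≡density*C {r} {m} H N≢0 = *-cancelʳ-fromℕ (begin
  averageDegree H * fromℕ (suc m)              ≡⟨ ratio-* (suc r ℕ.* edgeCount H) m ⟩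
  fromℕ (suc r ℕ.* edgeCount H)                ≡⟨ fromℕ-* (suc r) (edgeCount H) ⟩
  fromℕ (suc r) * fromℕ (edgeCount H)          ≡⟨ cong (fromℕ (suc r) *_) (sym (density-* (suc m C suc r) N≢0)) ⟩
  fromℕ (suc r) * (density H * fromℕ N)        ≡⟨ e₁ (fromℕ (suc r)) (density H) (fromℕ N) ⟩
  density H * (fromℕ (suc r) * fromℕ N)        ≡⟨ cong (density H *_) (sym (fromℕ-* (suc r) N)) ⟩
  density H * fromℕ (suc r ℕ.* N)              ≡⟨ cong (λ z → density H * fromℕ z) (sym (binomial-absorption m r)) ⟩
  density H * fromℕ (suc m ℕ.* (m C r))        ≡⟨ cong (density H *_) (fromℕ-* (suc m) (m C r)) ⟩
  density H * (fromℕ (suc m) * fromℕ (m C r))  ≡⟨ e₂ (density H) (fromℕ (suc m)) (fromℕ (m C r)) ⟩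
  density H * fromℕ (m C r) * fromℕ (suc m)    ∎)
  where
  open ≡-Reasoning
  N : ℕ
  N = suc m C suc r
  density-* : ∀ b → b ≢ 0 → ratio (edgeCount H) b * fromℕ b ≡ fromℕ (edgeCount H)
  density-* zero    b≢0 = contradiction refl b≢0
  density-* (suc b) _   = ratio-* (edgeCount H) b
  e₁ : ∀ a b c → a * (b * c) ≡ b * (a * c)
  e₁ = solve-∀ ringℚ
  e₂ : ∀ a b c → a * (b * c) ≡ a * c * b
  e₂ = solve-∀ ringℚ
  *-cancelʳ-fromℕ : ∀ {p q} → p * fromℕ (suc m) ≡ q * fromℕ (suc m) → p ≡ q
  *-cancelʳ-fromℕ eq = ≤-antisym (cancel (≤-reflexive eq)) (cancel (≤-reflexive (sym eq)))
    where
    cancel : ∀ {p q} → p * fromℕ (suc m) ≤ q * fromℕ (suc m) → p ≤ q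
    cancel = *-cancelʳ-≤-pos (fromℕ (suc m)) {{positive (0<fromℕ m)}}

-- The factor 4 is 2 · 2: one 2 for the two gradient sums, one for s ≤ 2k. The 8 and 3ʳ come from
-- the bound at each vertex.
discConst : ℕ → ℚ
discConst r = 8ℚ * (4ℚ * (3ℚ ^ r * gradConst r))

0<discConst : ∀ r → 0ℚ < discConst r
0<discConst r = <-≤-trans (positive⁻¹ 1ℚ)
  (1≤* {8ℚ} (≤ᵇ⇒≤ _) (1≤* {4ℚ} (≤ᵇ⇒≤ _) (1≤* (1≤^ r 1≤3) (1≤* 1≤K (1≤* (1≤^ (suc r) 1≤2) (1≤* 1≤K (1≤^ (suc r) 1≤3)))))))
  where
  1≤2 : 1ℚ ≤ 2ℚ
  1≤2 = ≤ᵇ⇒≤ _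
  1≤3 : 1ℚ ≤ 3ℚ
  1≤3 = ≤ᵇ⇒≤ _
  1≤K : 1ℚ ≤ polyConst (suc r)
  1≤K = 1≤polyConst (suc r)

s*n≤discConst*disc : ∀ {r m} (H : Hypergraph (suc r) (suc m)) → 1ℚ ≤ averageDegree H →
  averageDegree H ≤ ½ * fromℕ (m C r) → ∀ s → s ≤√ averageDegree H → s * fromℕ (suc m) ≤ discConst r * disc H
s*n≤discConst*disc {r} {m} H 1≤d d≤½C s (_ , ss≤d) = ≤-trans (*-monoʳ-≤ (0≤fromℕ (suc m)) s≤2k)
  (≤-respˡ (e₂ k (fromℕ (suc m))) (≤-respʳ (e₃ (3ℚ ^ r) (gradConst r) (disc H)) (*-monoˡ-≤ 0≤2 (vertex-sum r w bounded
    (vertex-bound r (indicator (edges H)) (indicator-idem (unique H)) (0≤ratio (edgeCount H) N) p≤½ d≡pC 1≤k kk≤d d≤4kk)))))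
  where
  d : ℚ
  d = averageDegree H
  N : ℕ
  N = suc m C suc r
  w : Subset (suc m) → ℚ
  w e = 1ℚ * indicator (edges H) e + - density H * 1ℚ
  bounded : ∀ U → ∣ form (suc r) w (χ U) ∣ ≤ disc H
  bounded U = ≤-respˡ (cong ∣_∣ (form-discOf H U)) (∣discOf∣≤disc H U)
  -- 1 ≤ d ≤ C/2 forces the binomial C = `m C r` to be positive, and with it `N`.
  0<½C : 0ℚ < ½ * fromℕ (m C r)
  0<½C = <-≤-trans (positive⁻¹ 1ℚ) (≤-trans 1≤d d≤½C)
  C≢0 : m C r ≢ 0
  C≢0 eq = <-irrefl (cong (λ z → ½ * fromℕ z) (sym eq)) 0<½C
  N≢0 : N ≢ 0
  N≢0 eq with ℕ.m*n≡0⇒m≡0∨n≡0 (suc m) (trans (binomial-absorption m r) (trans (cong (suc r ℕ.*_) eq) (ℕ.*-zeroʳ (suc r))))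
  ... | inj₂ C≡0 = C≢0 C≡0
  d≡pC : d ≡ density H * fromℕ (m C r)
  d≡pC = averageDegree≡density*C H N≢0
  0<C : ∀ c → c ≢ 0 → 0ℚ < fromℕ c
  0<C zero    c≢0 = contradiction refl c≢0
  0<C (suc c) _   = 0<fromℕ c
  p≤½ : density H ≤ ½
  p≤½ = *-cancelʳ-≤-pos (fromℕ (m C r)) {{positive (0<C (m C r) C≢0)}} (≤-respˡ (sym d≡pC) d≤½C)
  e₁ : ∀ x → x * (4ℚ * (1ℚ * 1ℚ)) ≡ ½ * x + (½ + 3ℚ) * x
  e₁ = solve-∀ ringℚ
  0≤4^ : 0ℚ ≤ 4ℚ ^ (m C r)
  0≤4^ = 0≤^ (m C r) (≤ᵇ⇒≤ _)
  -- The doubling starts at 1, as d ≥ 1. The crude chain d ≤ C/2 ≤ 4^C · 4, with C = `m C r`, lets C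
  -- itself bound the number of doublings.
  root : ∃[ l ] (1ℚ ≤ l × l * l ≤ d × d ≤ 4ℚ * (l * l))
  root = approximate-root (m C r) {d} {1ℚ} ≤-refl 1≤d (≤-trans d≤½C (≤-trans (*-monoˡ-≤ 0≤½ (fromℕ≤4^ (m C r)))
    (q≡p+z⇒p≤q _ (e₁ (4ℚ ^ (m C r))) (0≤* {½ + 3ℚ} (≤ᵇ⇒≤ _) 0≤4^))))
  k : ℚ
  k = proj₁ root
  1≤k : 1ℚ ≤ k
  1≤k = proj₁ (proj₂ root)
  kk≤d : k * k ≤ d
  kk≤d = proj₁ (proj₂ (proj₂ root))
  d≤4kk : d ≤ 4ℚ * (k * k)
  d≤4kk = proj₂ (proj₂ (proj₂ root))
  e₂ : ∀ k n → 2ℚ * k * n ≡ 2ℚ * (n * k)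
  e₂ = solve-∀ ringℚ
  e₃ : ∀ T G M → 2ℚ * (8ℚ * (T * (G * M + G * M))) ≡ 8ℚ * (4ℚ * (T * G)) * M
  e₃ = solve-∀ ringℚ
  e₄ : ∀ k → 4ℚ * (k * k) ≡ 2ℚ * k * (2ℚ * k)
  e₄ = solve-∀ ringℚ
  s≤2k : s ≤ 2ℚ * k
  s≤2k = p*p≤q*q⇒p≤q (0≤* 0≤2 (≤-trans 0≤1 1≤k)) (≤-respʳ (e₄ k) (≤-trans ss≤d d≤4kk))

theorem1p3 : (r : ℕ) → 2 ℕ.≤ r →
    ∃[ c ] (0ℚ < c ×
    ((n : ℕ) (H : Hypergraph r n) →
    1ℚ ≤ averageDegree H →
    averageDegree H ≤ ½ * fromℕ ((n ∸ 1) C (r ∸ 1)) →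
    ∀ s → s ≤√ averageDegree H → c * s * fromℕ n ≤ disc H))
theorem1p3 (suc r) _ = c , 0<c , bound
  where
  L : ℚ
  L = discConst r
  instance
    L-positive : Positive L
    L-positive = positive (0<discConst r)
    L-nonZero : NonZero L
    L-nonZero = pos⇒nonZero L
  c : ℚ
  c = 1/ L
  0<c : 0ℚ < c
  0<c = positive⁻¹ c {{1/pos⇒pos L}}
  bound : (n : ℕ) (H : Hypergraph (suc r) n) → 1ℚ ≤ averageDegree H →
    averageDegree H ≤ ½ * fromℕ ((n ∸ 1) C r) → ∀ s → s ≤√ averageDegree H → c * s * fromℕ n ≤ disc H
  -- For n = 0 the average degree takes the default value 0, against d ≥ 1.
  bound zero    H 1≤d _ _ _ = contradiction (<-≤-trans (positive⁻¹ 1ℚ) 1≤d) (<-irrefl refl)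
  bound (suc m) H 1≤d d≤½C s s≤√d = ≤-respˡ (*-assoc c s (fromℕ (suc m)))
    (≤-respʳ (trans (sym (*-assoc c L (disc H))) (trans (cong (_* disc H) (*-inverseˡ L)) (*-identityˡ (disc H))))
      (*-monoˡ-≤ (<⇒≤ 0<c) (s*n≤discConst*disc H 1≤d d≤½C s s≤√d)))
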